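{- Let $n$ be a perfect square and let $G$ be a $\sqrt{n}\times\sqrt{n}$ integer grid of $n$ points. Then the largest size of a monotone general position subset of $G$ is at least $\Omega\!\left((n/\log n)^{2/5}\right)$ and at most $o(n^{1/2})$.
   Context: A point set $P\subseteq\mathbb{R}^2$ is monotone if either (i) for all $u,v\in P$, $u_x<v_x$ implies $u_y\le v_y$, or (ii) for all $u,v\in P$, $u_x<v_x$ implies $u_y\ge v_y$. A set is in general position if it contains no three collinear points. Asymptotic notation refers to $n\to\infty$. -}

module Defs where

open import Data.Nat using (ℕ; _<_; _≤_; _*_; _^_)
open import Data.Nat.Logarithm using (⌊log₂_⌋)
open import Data.Integer as ℤ using (ℤ; +_)
open import Data.Product using (_×_; _,_; proj₁; proj₂)
open import Data.Sum using (_⊎_)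
open import Data.List using (List; length)
open import Data.List.Membership.Propositional using (_∈_)
open import Data.List.Relation.Unary.All using (All)
open import Data.List.Relation.Unary.Unique.Propositional using (Unique)
open import Relation.Binary.PropositionalEquality using (_≡_; _≢_)
open import Relation.Nullary using (¬_)

Point : Set
Point = ℕ × ℕ

xc yc : Point → ℤ
xc p = + proj₁ p
yc p = + proj₂ p

InGrid : ℕ → Point → Set
InGrid k p = (proj₁ p < k) × (proj₂ p < k)

-- Three points are collinear iff (v - u) × (w - u) = 0.
Collinear : Point → Point → Point → Set
Collinear u v w =
  (xc v ℤ.- xc u) ℤ.* (yc w ℤ.- yc u) ≡ (yc v ℤ.- yc u) ℤ.* (xc w ℤ.- xc u)

GeneralPosition : List Point → Set
GeneralPosition P = ∀ {u v w} → u ∈ P → v ∈ P → w ∈ P →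
  u ≢ v → v ≢ w → u ≢ w → ¬ Collinear u v w

Monotone : List Point → Set
Monotone P =
  (∀ {u v} → u ∈ P → v ∈ P → proj₁ u < proj₁ v → proj₂ u ≤ proj₂ v)
  ⊎ (∀ {u v} → u ∈ P → v ∈ P → proj₁ u < proj₁ v → proj₂ v ≤ proj₂ u)

MGPSubset : ℕ → List Point → Set
MGPSubset k S = Unique S × All (InGrid k) S × Monotone S × GeneralPosition S

{-# OPTIONS --safe #-}
module Submission where

-- Upper bound.  Along a chain, use s = x + y as parameter (after reflecting a decreasing chain) and
-- attach to a window of length L, with M points and displacement X in the coordinate x, the potential
-- 8 m M / L + (X / L)².  A window that is both dense and within L / Q² of its chord is covered by few
-- lines of a direction of height at most Q (Dirichlet), so pigeonhole puts three of its points on a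
-- line.  A window with a point far from its chord can be cut there, and strict convexity makes the
-- potential of one of the two pieces larger by a fixed amount; as the potential is bounded and also
-- controls the density, this can only be repeated a bounded number of times.
--
-- Lower bound.  Choose a uniformly random point in each of t = r² consecutive b × b blocks along the
-- curve y = x + x² / A, where A = b t.  A collinear triple P, P + α (w, w₂), P + n (w, w₂) near this curve
-- satisfies α (n − α) w² ≤ 2 A b, and (n w, n w₂) confines the abscissa of P to an interval of length
-- O(A b / (n w)).  Hence there are O(b⁴ r³ log A) collinear triples of points in distinct blocks, each
-- chosen with probability b⁻⁶, so when b² is a large multiple of r log A half of the points survive the
-- removal of one point of every collinear triple.

-- Upper bound: cutting a bent window raises the quadratic term of one piece, but that piece may be
-- the sparse one. The density `M / L` is affine under a cut: its mean over the pieces, weighted by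
-- length, is exactly that of the whole. Added to the convex term it therefore keeps the whole gain,
-- and the chosen piece may trade density against slope. The trade is limited because `(X / L)²` is
-- at most 1: a potential of at least 2 always leaves `8 m M / L ≥ 1`, and the weight `8 m` is what
-- makes a set of more than `k / m` points start at 2. Lower bound: `√(A b)` is the horizontal scale
-- on which the parabola leaves its chords by about `b`, so it governs how far apart the points of a
-- collinear triple can lie. Taking `t` a square makes it the integer `Z = b r`. With `l` the
-- logarithm, the balance between `b²` and `r l` is met exactly by `b = 35 m l`, `r = m² l`; the
-- grid then has side of order `b r²`, that is `m⁵ l³`, for `r² = m⁴ l²` blocks, and
-- `(m⁵ l³)⁴ = (m⁴ l²)⁵ l²` is the exponent claimed.

open import Defs
open import Data.Empty using (⊥)
open import Data.Fin using (toℕ; fromℕ<)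
open import Data.Fin.Properties using (pigeonhole; toℕ-fromℕ<; toℕ<n)
open import Data.Integer as ℤ using (ℤ)
import Data.Integer.Properties as ℤ
open import Data.Integer.Tactic.RingSolver using () renaming (solve-∀ to ℤ-solve-∀)
open import Data.List using (List; []; _∷_; length; map; _++_; filter; downFrom; drop; cartesianProduct)
open import Data.List.Extrema.Nat using (argmin; argmax; argmin-sel; argmax-sel; f[argmin]≤f[xs]; f[xs]≤f[argmax])
open import Data.List.Membership.Propositional using (_∈_; find; lose)
open import Data.List.Membership.Propositional.Properties
open import Data.List.Properties using (length-downFrom; length-map)
open import Data.List.Relation.Unary.All as All using ([]; _∷_)
import Data.List.Relation.Unary.All.Properties as All
open import Data.List.Relation.Unary.AllPairs using ([]; _∷_)
open import Data.List.Relation.Unary.Any using (here; there; any?)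
open import Data.List.Relation.Unary.Unique.Propositional using (Unique)
import Data.List.Relation.Unary.Unique.Propositional.Properties as Unique
open import Data.Nat
open import Data.Nat.Coprimality using (coprime-/gcd; coprime-divisor) renaming (sym to coprime-sym)
open import Data.Nat.Divisibility using (_∣_; n∣m*n)
open import Data.Nat.DivMod
open import Data.Nat.GCD using (gcd; gcd[m,n]∣m; gcd[m,n]∣n; gcd[m,n]≢0)
open import Data.Nat.Logarithm using (⌊log₂_⌋; ⌊log₂⌋-mono-≤; ⌊log₂[2^n]⌋≡n)
open import Data.Nat.Properties
open import Data.Nat.Tactic.RingSolver using (solve-∀)
open import Data.Product using (_×_; Σ; ∃; ∃₂; _,_; proj₁; proj₂)
open import Data.Product.Properties using (,-injectiveˡ; ,-injectiveʳ) renaming (≡-dec to ×-≡-dec)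
open import Data.Sum using (_⊎_; inj₁; inj₂)
open import Function using (it; _∘_)
open import Relation.Binary.Definitions using (Tri; tri<; tri≈; tri>)
open import Relation.Binary.PropositionalEquality
open import Relation.Nullary using (¬_; Dec; yes; no; contradiction; _×-dec_)

-- Finite sums and counting

private variable
  𝐀 𝐁 : Set

∑ : List 𝐀 → (𝐀 → ℕ) → ℕ
∑ []       f = 0
∑ (x ∷ xs) f = f x + ∑ xs f

syntax ∑ xs (λ x → e) = ∑[ x ∈ xs ] e

∑-mono : ∀ (xs : List 𝐀) {f g : 𝐀 → ℕ} → (∀ {x} → x ∈ xs → f x ≤ g x) → ∑ xs f ≤ ∑ xs g
∑-mono []       f≤g = z≤n
∑-mono (x ∷ xs) f≤g = +-mono-≤ (f≤g (here refl)) (∑-mono xs (λ x∈ → f≤g (there x∈)))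

∑-cong : ∀ (xs : List 𝐀) {f g : 𝐀 → ℕ} → (∀ x → f x ≡ g x) → ∑ xs f ≡ ∑ xs g
∑-cong []       f≡g = refl
∑-cong (x ∷ xs) f≡g = cong₂ _+_ (f≡g x) (∑-cong xs f≡g)

∑-+ : ∀ (xs : List 𝐀) (f g : 𝐀 → ℕ) → ∑ xs (λ x → f x + g x) ≡ ∑ xs f + ∑ xs g
∑-+ []       f g = refl
∑-+ (x ∷ xs) f g = trans (cong (f x + g x +_) (∑-+ xs f g)) (interchange (f x) (g x) _ _)
  where
  interchange : ∀ a b c d → a + b + (c + d) ≡ a + c + (b + d)
  interchange = solve-∀

∑-0 : ∀ (xs : List 𝐀) → ∑ xs (λ _ → 0) ≡ 0
∑-0 []       = refl
∑-0 (x ∷ xs) = ∑-0 xs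

∑-swap : ∀ (xs : List 𝐀) (ys : List 𝐁) (f : 𝐀 → 𝐁 → ℕ) →
  ∑[ x ∈ xs ] ∑[ y ∈ ys ] f x y ≡ ∑[ y ∈ ys ] ∑[ x ∈ xs ] f x y
∑-swap []       ys f = sym (∑-0 ys)
∑-swap (x ∷ xs) ys f = trans (cong (∑ ys (f x) +_) (∑-swap xs ys f)) (sym (∑-+ ys (f x) _))

∑-*ˡ : ∀ (xs : List 𝐀) c (f : 𝐀 → ℕ) → ∑ xs (λ x → c * f x) ≡ c * ∑ xs f
∑-*ˡ []       c f = sym (*-zeroʳ c)
∑-*ˡ (x ∷ xs) c f = trans (cong (c * f x +_) (∑-*ˡ xs c f)) (sym (*-distribˡ-+ c (f x) _))

∑-const : ∀ (xs : List 𝐀) c → ∑ xs (λ _ → c) ≡ length xs * c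
∑-const []       c = refl
∑-const (x ∷ xs) c = cong (c +_) (∑-const xs c)

∑-++ : ∀ (xs ys : List 𝐀) (f : 𝐀 → ℕ) → ∑ (xs ++ ys) f ≡ ∑ xs f + ∑ ys f
∑-++ []       ys f = refl
∑-++ (x ∷ xs) ys f = trans (cong (f x +_) (∑-++ xs ys f)) (sym (+-assoc (f x) _ _))

∑-map : ∀ (h : 𝐀 → 𝐁) (xs : List 𝐀) (f : 𝐁 → ℕ) → ∑ (map h xs) f ≡ ∑ xs (λ x → f (h x))
∑-map h []       f = refl
∑-map h (x ∷ xs) f = cong (f (h x) +_) (∑-map h xs f)

term≤∑ : ∀ {x : 𝐀} {xs} (f : 𝐀 → ℕ) → x ∈ xs → f x ≤ ∑ xs f
term≤∑ f (here refl) = m≤m+n _ _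
term≤∑ f (there x∈)  = ≤-trans (term≤∑ f x∈) (m≤n+m _ _)

∑≤length* : ∀ (xs : List 𝐀) {f : 𝐀 → ℕ} c → (∀ {x} → x ∈ xs → f x ≤ c) → ∑ xs f ≤ length xs * c
∑≤length* xs c f≤c = ≤-trans (∑-mono xs f≤c) (≤-reflexive (∑-const xs c))

𝟙 : Dec 𝐀 → ℕ
𝟙 (yes _) = 1
𝟙 (no _)  = 0

𝟙≤1 : (a? : Dec 𝐀) → 𝟙 a? ≤ 1
𝟙≤1 (yes _) = ≤-refl
𝟙≤1 (no _)  = z≤n

𝟙-yes : (a? : Dec 𝐀) → 𝐀 → 𝟙 a? ≡ 1
𝟙-yes (yes _) a = refl
𝟙-yes (no ¬a) a = contradiction a ¬a

𝟙-no : (a? : Dec 𝐀) → ¬ 𝐀 → 𝟙 a? ≡ 0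
𝟙-no (yes a) ¬a = contradiction a ¬a
𝟙-no (no _)  ¬a = refl

𝟙-mono : (a? : Dec 𝐀) (b? : Dec 𝐁) → (𝐀 → 𝐁) → 𝟙 a? ≤ 𝟙 b?
𝟙-mono (yes a) b? a→b = ≤-reflexive (sym (𝟙-yes b? (a→b a)))
𝟙-mono (no _)  b? a→b = z≤n

module _ {P : 𝐀 → Set} (P? : ∀ x → Dec (P x)) where

  ∑𝟙≡length-filter : ∀ xs → ∑ xs (λ x → 𝟙 (P? x)) ≡ length (filter P? xs)
  ∑𝟙≡length-filter []       = refl
  ∑𝟙≡length-filter (x ∷ xs) with P? x
  ... | yes _ = cong suc (∑𝟙≡length-filter xs)
  ... | no _  = ∑𝟙≡length-filter xs

  atMostOne : ∀ {xs} → Unique xs → (∀ {x y} → x ∈ xs → y ∈ xs → P x → P y → ¬ x ≢ y) →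
    ∑ xs (λ x → 𝟙 (P? x)) ≤ 1
  atMostOne {xs = xs} unique sep = subst (_≤ 1) (sym (∑𝟙≡length-filter xs))
      (go (filter P? xs) (Unique.filter⁺ P? unique) (∈-filter⁻ P? {xs = xs}))
    where
    go : ∀ ys → Unique ys → (∀ {y} → y ∈ ys → y ∈ xs × P y) → length ys ≤ 1
    go []          _                    _  = z≤n
    go (_ ∷ [])    _                    _  = s≤s z≤n
    go (_ ∷ _ ∷ _) ((x≢y ∷ _) ∷ _) ∈P
      with x∈ , px ← ∈P (here refl) | y∈ , py ← ∈P (there (here refl)) =
      contradiction x≢y (sep x∈ y∈ px py)

  -- The form in which general position enters a count: a line carries at most two points.
  atMostTwo : ∀ {xs} → Unique xs →
    (∀ {x y z} → x ∈ xs → y ∈ xs → z ∈ xs → P x → P y → P z → x ≢ y → y ≢ z → ¬ x ≢ z) →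
    ∑ xs (λ x → 𝟙 (P? x)) ≤ 2
  atMostTwo {xs = xs} unique sep = subst (_≤ 2) (sym (∑𝟙≡length-filter xs))
      (go (filter P? xs) (Unique.filter⁺ P? unique) (∈-filter⁻ P? {xs = xs}))
    where
    go : ∀ ys → Unique ys → (∀ {y} → y ∈ ys → y ∈ xs × P y) → length ys ≤ 2
    go []              _ _ = z≤n
    go (_ ∷ [])        _ _ = s≤s z≤n
    go (_ ∷ _ ∷ [])    _ _ = s≤s (s≤s z≤n)
    go (_ ∷ _ ∷ _ ∷ _) ((x≢y ∷ x≢z ∷ _) ∷ (y≢z ∷ _) ∷ _) ∈P
      with x∈ , px ← ∈P (here refl) | y∈ , py ← ∈P (there (here refl))
         | z∈ , pz ← ∈P (there (there (here refl))) =
      contradiction x≢z (sep x∈ y∈ z∈ px py pz x≢y y≢z)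

  fibres : ∀ {xs} (h : 𝐀 → ℕ) n c → (∀ {x} → x ∈ xs → P x → h x < n) →
    (∀ v → ∑ xs (λ x → 𝟙 (P? x ×-dec h x ≟ v)) ≤ c) → ∑ xs (λ x → 𝟙 (P? x)) ≤ n * c
  fibres {xs = xs} h n c h<n fibre≤c = begin
    ∑ xs (λ x → 𝟙 (P? x))                                       ≤⟨ ∑-mono xs split ⟩
    ∑[ x ∈ xs ] ∑[ v ∈ downFrom n ] 𝟙 (P? x ×-dec h x ≟ v)   ≡⟨ ∑-swap xs (downFrom n) _ ⟩
    ∑[ v ∈ downFrom n ] ∑[ x ∈ xs ] 𝟙 (P? x ×-dec h x ≟ v)   ≤⟨ ∑≤length* (downFrom n) c (λ {v} _ → fibre≤c v) ⟩
    length (downFrom n) * c                                     ≡⟨ cong (_* c) (length-downFrom n) ⟩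
    n * c                                                       ∎
    where
    open ≤-Reasoning
    split : ∀ {x} → x ∈ xs → 𝟙 (P? x) ≤ ∑[ v ∈ downFrom n ] 𝟙 (P? x ×-dec h x ≟ v)
    split {x} x∈ with P? x
    ... | no _   = z≤n
    ... | yes px = begin
      1                                                ≡⟨ sym (𝟙-yes (yes px ×-dec h x ≟ h x) (px , refl)) ⟩
      𝟙 (yes px ×-dec h x ≟ h x)                       ≤⟨ term≤∑ (λ v → 𝟙 (yes px ×-dec h x ≟ v)) (∈-downFrom⁺ (h<n x∈ px)) ⟩
      ∑[ v ∈ downFrom n ] 𝟙 (yes px ×-dec h x ≟ v)     ∎

average : ∀ (xs : List 𝐀) (f : 𝐀 → ℕ) → 0 < length xs → ∃ λ x → x ∈ xs × length xs * f x ≤ ∑ xs f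
average (x ∷ [])         f _ = x , here refl , ≤-refl
average (x ∷ xs@(_ ∷ _)) f _ with average xs f (s≤s z≤n)
... | y , y∈ , avg with ≤-total (f x) (f y)
...   | inj₁ fx≤fy = x , here refl , +-monoʳ-≤ (f x) (≤-trans (*-monoʳ-≤ (length xs) fx≤fy) avg)
...   | inj₂ fy≤fx = y , there y∈ , +-mono-≤ fy≤fx avg

-- Ranges, and averages over sequences of choices

_⊗_ : List 𝐀 → (𝐀 → List 𝐁) → List (𝐀 × 𝐁)
[]       ⊗ ys = []
(x ∷ xs) ⊗ ys = map (x ,_) (ys x) ++ (xs ⊗ ys)

infixl 5 _⊗_

∑-⊗ : ∀ (xs : List 𝐀) (ys : 𝐀 → List 𝐁) (f : 𝐀 × 𝐁 → ℕ) →
  ∑ (xs ⊗ ys) f ≡ ∑[ x ∈ xs ] ∑[ y ∈ ys x ] f (x , y)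
∑-⊗ []       ys f = refl
∑-⊗ (x ∷ xs) ys f = trans (∑-++ (map (x ,_) (ys x)) (xs ⊗ ys) f)
  (cong₂ _+_ (∑-map (x ,_) (ys x) f) (∑-⊗ xs ys f))

∈-⊗⁺ : ∀ {x : 𝐀} {y : 𝐁} {xs ys} → x ∈ xs → y ∈ ys x → (x , y) ∈ xs ⊗ ys
∈-⊗⁺ (here refl) y∈ = ∈-++⁺ˡ (∈-map⁺ _ y∈)
∈-⊗⁺ {ys = ys} (there {x = z} x∈) y∈ = ∈-++⁺ʳ (map (z ,_) (ys z)) (∈-⊗⁺ x∈ y∈)

∑-cartesianProduct : ∀ (xs : List 𝐀) (ys : List 𝐁) (f : 𝐀 × 𝐁 → ℕ) →
  ∑ (cartesianProduct xs ys) f ≡ ∑[ x ∈ xs ] ∑[ y ∈ ys ] f (x , y)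
∑-cartesianProduct []       ys f = refl
∑-cartesianProduct (x ∷ xs) ys f = trans (∑-++ (map (x ,_) ys) (cartesianProduct xs ys) f)
  (cong₂ _+_ (∑-map (x ,_) ys f) (∑-cartesianProduct xs ys f))

-- Division with the junk value m ÷ 0 = 0.
_÷_ : ℕ → ℕ → ℕ
m ÷ zero    = 0
m ÷ n@(suc _) = m / n

infixl 7 _÷_

÷-* : ∀ m n → m ÷ n * n ≤ m
÷-* m zero    = z≤n
÷-* m (suc n) = m/n*n≤m m (suc n)

≤-÷ : ∀ {k m n} → 1 ≤ n → k * n ≤ m → k ≤ m ÷ n
≤-÷ {k} {m} {suc n} _ kn≤m = subst (_≤ m / suc n) (m*n/n≡m k (suc n)) (/-monoˡ-≤ (suc n) kn≤m)

<-÷ : ∀ m n → 1 ≤ n → m < suc (m ÷ n) * n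
<-÷ m n@(suc _) _ = subst (_< suc (m / n) * n) (sym (m≡m%n+[m/n]*n m n)) (+-monoˡ-< (m / n * n) (m%n<n m n))

∑-range-+ : ∀ m n (g : ℕ → ℕ) → ∑ (downFrom (m + n)) g ≡ ∑ (downFrom m) g + ∑[ u ∈ downFrom n ] g (m + u)
∑-range-+ m zero    g rewrite +-identityʳ m = sym (+-identityʳ _)
∑-range-+ m (suc n) g rewrite +-suc m n = trans (cong (g (m + n) +_) (∑-range-+ m n g)) (e (g (m + n)) (∑ (downFrom m) g) (∑[ u ∈ downFrom n ] g (m + u)))
  where
  e : ∀ a b c → a + (b + c) ≡ b + (a + c)
  e = solve-∀

∑-blocks : ∀ b t (g : ℕ → ℕ) → ∑[ i ∈ downFrom t ] ∑[ u ∈ downFrom b ] g (b * i + u) ≡ ∑ (downFrom (b * t)) g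
∑-blocks b zero    g rewrite *-zeroʳ b = refl
∑-blocks b (suc t) g = begin
  ∑[ u ∈ downFrom b ] g (b * t + u) + ∑[ i ∈ downFrom t ] ∑[ u ∈ downFrom b ] g (b * i + u)
    ≡⟨ cong (∑[ u ∈ downFrom b ] g (b * t + u) +_) (∑-blocks b t g) ⟩
  ∑[ u ∈ downFrom b ] g (b * t + u) + ∑ (downFrom (b * t)) g
    ≡⟨ +-comm (∑[ u ∈ downFrom b ] g (b * t + u)) _ ⟩
  ∑ (downFrom (b * t)) g + ∑[ u ∈ downFrom b ] g (b * t + u)
    ≡⟨ sym (∑-range-+ (b * t) b g) ⟩
  ∑ (downFrom (b * t + b)) g
    ≡⟨ cong (λ n → ∑ (downFrom n) g) (trans (+-comm (b * t) b) (sym (*-suc b t))) ⟩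
  ∑ (downFrom (b * suc t)) g ∎
  where open ≡-Reasoning

module _ {P : ℕ → Set} (P? : ∀ a → Dec (P a)) where

  count : ℕ → ℕ
  count N = ∑ (downFrom N) (λ a → 𝟙 (P? a))

  count≤ : ∀ N → count N ≤ N
  count≤ N = subst (count N ≤_) (trans (*-identityʳ _) (length-downFrom N))
    (∑≤length* (downFrom N) 1 (λ {a} _ → 𝟙≤1 (P? a)))

  count-above : ∀ N lo → (∀ {a} → a < N → P a → lo ≤ a) → count N ≤ N ∸ lo
  count-above zero    lo low = z≤n
  count-above (suc N) lo low with P? N
  ... | yes pN = subst (suc (count N) ≤_) (sym (+-∸-assoc 1 (low ≤-refl pN)))
                   (s≤s (count-above N lo (λ a<N → low (m≤n⇒m≤1+n a<N))))
  ... | no  _  = ≤-trans (count-above N lo (λ a<N → low (m≤n⇒m≤1+n a<N))) (∸-monoˡ-≤ lo (n≤1+n N))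

  count-top : ∀ N M → (∀ {a} → a < N → P a → N ≤ a + M) → count N ≤ M
  count-top N M near = ≤-trans (count-above N (N ∸ M) (λ {a} a<N pa → m≤n+o⇒m∸n≤o N M (subst (N ≤_) (+-comm a M) (near a<N pa))))
    (m≤n+o⇒m∸n≤o N (N ∸ M) (subst (N ≤_) (+-comm M (N ∸ M)) (m≤n+m∸n N M)))

  count-bottom : ∀ N M → (∀ {a} → a < N → P a → 1 ≤ a × a ≤ M) → count N ≤ M
  count-bottom N M near = subst (count N ≤_) (*-identityʳ M)
    (fibres P? pred M 1 (λ a∈ pa → pred<M (near (∈-downFrom⁻ a∈) pa))
      (λ v → atMostOne (λ a → P? a ×-dec pred a ≟ v) (Unique.downFrom⁺ N)
        (λ a∈ b∈ (pa , ea) (pb , eb) a≢b → a≢b (pred-inj (proj₁ (near (∈-downFrom⁻ a∈) pa)) (proj₁ (near (∈-downFrom⁻ b∈) pb)) (trans ea (sym eb))))))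
    where
    pred<M : ∀ {a} → 1 ≤ a × a ≤ M → pred a < M
    pred<M {suc a} (_ , a≤M) = a≤M
    pred-inj : ∀ {a b} → 1 ≤ a → 1 ≤ b → pred a ≡ pred b → a ≡ b
    pred-inj {suc a} {suc b} _ _ = cong suc

  -- Everything counted lies within `M` below the largest element satisfying `P`, which is found by
  -- descending from `N`.
  count-spread : ∀ N M → (∀ {a a′} → a ≤ a′ → P a → P a′ → a′ ≤ a + M) → count N ≤ suc M
  count-spread zero    M spread = z≤n
  count-spread (suc N) M spread with P? N
  ... | yes pN = s≤s (count-top N M (λ a<N pa → spread (<⇒≤ a<N) pa pN))
  ... | no  _  = count-spread N M spread

-- Harmonic and inverse-square sums, and the ratios of collinear triples

interval : ℕ → ℕ → List ℕ
interval V zero    = []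
interval V (suc j) = V ∷ interval (suc V) j

∈-interval⁺ : ∀ {w} V j → V ≤ w → w < V + j → w ∈ interval V j
∈-interval⁺ V zero    V≤w w< = contradiction (subst (_ <_) (+-identityʳ V) w<) (≤⇒≯ V≤w)
∈-interval⁺ {w} V (suc j) V≤w w< with V ≟ w
... | yes refl = here refl
... | no V≢w   = there (∈-interval⁺ (suc V) j (≤∧≢⇒< V≤w V≢w) (subst (w <_) (+-suc V j) w<))

∈-interval⁻ : ∀ {w} V j → w ∈ interval V j → V ≤ w
∈-interval⁻ V (suc j) (here refl) = ≤-refl
∈-interval⁻ V (suc j) (there w∈)  = <⇒≤ (∈-interval⁻ (suc V) j w∈)

length-interval : ∀ V j → length (interval V j) ≡ j
length-interval V zero    = refl
length-interval V (suc j) = cong suc (length-interval (suc V) j)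

∑-interval-+ : ∀ V i j g → ∑ (interval V (i + j)) g ≡ ∑ (interval V i) g + ∑ (interval (V + i) j) g
∑-interval-+ V zero    j g rewrite +-identityʳ V = refl
∑-interval-+ V (suc i) j g rewrite +-suc V i =
  trans (cong (g V +_) (∑-interval-+ (suc V) i j g)) (sym (+-assoc (g V) _ _))

∑-interval-≤ : ∀ V j c g → (∀ {w} → V ≤ w → g w ≤ c) → ∑ (interval V j) g ≤ j * c
∑-interval-≤ V j c g g≤ = subst (λ l → ∑ (interval V j) g ≤ l * c) (length-interval V j)
  (∑≤length* (interval V j) c (λ w∈ → g≤ (∈-interval⁻ V j w∈)))

-- The natural numbers in [1, 2^J).
dyadic : ℕ → List ℕ
dyadic zero    = []
dyadic (suc J) = dyadic J ++ interval (2 ^ J) (2 ^ J)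

∈-dyadic⁺ : ∀ {n} J → 1 ≤ n → n < 2 ^ J → n ∈ dyadic J
∈-dyadic⁺ zero    1≤n n<1 = contradiction n<1 (≤⇒≯ 1≤n)
∈-dyadic⁺ {n} (suc J) 1≤n n< with n <? 2 ^ J
... | yes n<2^J = ∈-++⁺ˡ (∈-dyadic⁺ J 1≤n n<2^J)
... | no  n≮2^J = ∈-++⁺ʳ (dyadic J) (∈-interval⁺ (2 ^ J) (2 ^ J) (≮⇒≥ n≮2^J)
                    (subst (n <_) (cong (2 ^ J +_) (+-identityʳ (2 ^ J))) n<))

∈-dyadic⁻ : ∀ {n} J → n ∈ dyadic J → 1 ≤ n
∈-dyadic⁻ (suc J) n∈ with ∈-++⁻ (dyadic J) n∈
... | inj₁ n∈ˡ = ∈-dyadic⁻ J n∈ˡ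
... | inj₂ n∈ʳ = ≤-trans (m^n>0 2 J) (∈-interval⁻ (2 ^ J) (2 ^ J) n∈ʳ)

-- Cauchy condensation: the block starting at `2 ^ j` has `2 ^ j` terms of size at most `M ÷ 2 ^ j`,
-- so each of the `J` blocks contributes at most `M`. This is the source of the logarithm in the
-- lower bound.
harmonic : ∀ M J → ∑[ n ∈ dyadic J ] (M ÷ n) ≤ J * M
harmonic M zero    = z≤n
harmonic M (suc J) = begin
  ∑[ n ∈ dyadic J ++ interval (2 ^ J) (2 ^ J) ] (M ÷ n)                 ≡⟨ ∑-++ (dyadic J) _ _ ⟩
  ∑[ n ∈ dyadic J ] (M ÷ n) + ∑[ n ∈ interval (2 ^ J) (2 ^ J) ] (M ÷ n)   ≤⟨ +-mono-≤ (harmonic M J) block ⟩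
  J * M + M                                                           ≡⟨ +-comm (J * M) M ⟩
  M + J * M                                                           ∎
  where
  open ≤-Reasoning
  block : ∑[ n ∈ interval (2 ^ J) (2 ^ J) ] (M ÷ n) ≤ M
  block = begin
    ∑[ n ∈ interval (2 ^ J) (2 ^ J) ] (M ÷ n)
      ≤⟨ ∑-interval-≤ (2 ^ J) (2 ^ J) (M ÷ 2 ^ J) (M ÷_)
           (λ {w} V≤w → ≤-÷ (m^n>0 2 J) (≤-trans (*-monoʳ-≤ (M ÷ w) V≤w) (÷-* M w))) ⟩
    2 ^ J * (M ÷ 2 ^ J)   ≡⟨ *-comm (2 ^ J) _ ⟩
    M ÷ 2 ^ J * 2 ^ J     ≤⟨ ÷-* M (2 ^ J) ⟩
    M                     ∎

-- After multiplication by `V + 1`, the first term is paid for by `V + 1 ≤ 2 V` and the rest by the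
-- induction hypothesis at `V + 1`.
inverse-square-tail : ∀ M V j → 1 ≤ V → V * ∑[ w ∈ interval V j ] (M ÷ (w * w)) ≤ 2 * M
inverse-square-tail M V zero    1≤V = subst (_≤ 2 * M) (sym (*-zeroʳ V)) z≤n
inverse-square-tail M V (suc j) 1≤V = *-cancelˡ-≤ (suc V) (begin
  suc V * (V * (M ÷ (V * V) + T))                ≡⟨ e₁ V (M ÷ (V * V)) T ⟩
  (suc V * V) * (M ÷ (V * V)) + V * (suc V * T)  ≤⟨ +-mono-≤ first (*-monoʳ-≤ V (inverse-square-tail M (suc V) j (s≤s z≤n))) ⟩
  2 * M + V * (2 * M)                            ≡⟨ refl ⟩
  suc V * (2 * M)                                ∎)
  where
  open ≤-Reasoning
  T = ∑[ w ∈ interval (suc V) j ] (M ÷ (w * w))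
  e₁ : ∀ V q T → suc V * (V * (q + T)) ≡ (suc V * V) * q + V * (suc V * T)
  e₁ = solve-∀
  e₂ : ∀ V q → (V + V) * V * q ≡ 2 * (q * (V * V))
  e₂ = solve-∀
  first : (suc V * V) * (M ÷ (V * V)) ≤ 2 * M
  first = begin
    (suc V * V) * (M ÷ (V * V))      ≤⟨ *-monoˡ-≤ (M ÷ (V * V)) (*-monoˡ-≤ V (+-monoˡ-≤ V 1≤V)) ⟩
    (V + V) * V * (M ÷ (V * V))      ≡⟨ e₂ V (M ÷ (V * V)) ⟩
    2 * (M ÷ (V * V) * (V * V))      ≤⟨ *-monoʳ-≤ 2 (÷-* M (V * V)) ⟩
    2 * M                            ∎

-- With `Z² = A b`, the curvature constraint on a collinear triple whose middle point divides it as
-- `α : n − α` and whose step has abscissa `w`.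
Ratio : ℕ → ℕ → ℕ → ℕ → Set
Ratio Z n w α = 1 ≤ α × α * (n ∸ α) * (w * w) ≤ 2 * (Z * Z)

ratio? : ∀ Z n w α → Dec (Ratio Z n w α)
ratio? Z n w α = 1 ≤? α ×-dec α * (n ∸ α) * (w * w) ≤? 2 * (Z * Z)

module Ratios (Z n : ℕ) (1≤Z : 1 ≤ Z) (1≤n : 1 ≤ n) where

  M = 4 * (Z * Z) ÷ n

  private
    bound : ∀ {w} → 1 ≤ w → ∀ p r → n ≤ 2 * r → p * r * (w * w) ≤ 2 * (Z * Z) → p ≤ M ÷ (w * w)
    bound {w} 1≤w p r n≤2r small = ≤-÷ (*-mono-≤ 1≤w 1≤w) (≤-÷ 1≤n (begin
      p * (w * w) * n            ≤⟨ *-monoʳ-≤ (p * (w * w)) n≤2r ⟩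
      p * (w * w) * (2 * r)      ≡⟨ e₁ p w r ⟩
      2 * (p * r * (w * w))      ≤⟨ *-monoʳ-≤ 2 small ⟩
      2 * (2 * (Z * Z))          ≡⟨ sym (*-assoc 2 2 (Z * Z)) ⟩
      4 * (Z * Z)                ∎))
      where
      open ≤-Reasoning
      e₁ : ∀ p w r → p * (w * w) * (2 * r) ≡ 2 * (p * r * (w * w))
      e₁ = solve-∀

    double : ∀ a → a + a ≡ 2 * a
    double a = cong (a +_) (sym (+-identityʳ a))

  -- The larger of `α` and `n ∸ α` is at least `n / 2`, so the smaller is at most `4 Z² / (n w²)`:
  -- only values of `α` near the two ends of `[0, n]` qualify.
  multiplicity≤ : ∀ {w} → 1 ≤ w → count (ratio? Z n w) n ≤ 2 * (M ÷ (w * w))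
  multiplicity≤ {w} 1≤w = begin
    count (ratio? Z n w) n                        ≤⟨ ∑-mono (downFrom n) (λ {a} _ → split a) ⟩
    ∑[ α ∈ downFrom n ] (𝟙 (low? α) + 𝟙 (high? α)) ≡⟨ ∑-+ (downFrom n) (λ α → 𝟙 (low? α)) _ ⟩
    count low? n + count high? n          ≤⟨ +-mono-≤ (count-bottom low? n (M ÷ (w * w)) low) (count-top high? n (M ÷ (w * w)) high) ⟩
    M ÷ (w * w) + M ÷ (w * w)             ≡⟨ double (M ÷ (w * w)) ⟩
    2 * (M ÷ (w * w))                     ∎
    where
    open ≤-Reasoning
    low? : ∀ α → Dec (Ratio Z n w α × α ≤ n ∸ α)
    low? α = ratio? Z n w α ×-dec α ≤? n ∸ α
    high? : ∀ α → Dec (Ratio Z n w α × n ∸ α ≤ α)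
    high? α = ratio? Z n w α ×-dec n ∸ α ≤? α
    split : ∀ α → 𝟙 (ratio? Z n w α) ≤ 𝟙 (low? α) + 𝟙 (high? α)
    split α with ≤-total α (n ∸ α)
    ... | inj₁ le = ≤-trans (𝟙-mono (ratio? Z n w α) (low? α) (λ c → c , le)) (m≤m+n _ _)
    ... | inj₂ ge = ≤-trans (𝟙-mono (ratio? Z n w α) (high? α) (λ c → c , ge)) (m≤n+m _ _)
    low : ∀ {α} → α < n → Ratio Z n w α × α ≤ n ∸ α → 1 ≤ α × α ≤ M ÷ (w * w)
    low {α} α<n ((1≤α , small) , le) = 1≤α , bound 1≤w α (n ∸ α)
      (begin n ≡⟨ sym (m+[n∸m]≡n (<⇒≤ α<n)) ⟩ α + (n ∸ α) ≤⟨ +-monoˡ-≤ _ le ⟩ (n ∸ α) + (n ∸ α) ≡⟨ double (n ∸ α) ⟩ 2 * (n ∸ α) ∎) small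
    high : ∀ {α} → α < n → Ratio Z n w α × n ∸ α ≤ α → n ≤ α + M ÷ (w * w)
    high {α} α<n ((_ , small) , ge) = ≤-trans (≤-reflexive (sym (m+[n∸m]≡n (<⇒≤ α<n)))) (+-monoʳ-≤ α
      (bound 1≤w (n ∸ α) α
        (begin n ≡⟨ sym (m+[n∸m]≡n (<⇒≤ α<n)) ⟩ α + (n ∸ α) ≤⟨ +-monoʳ-≤ α ge ⟩ α + α ≡⟨ double α ⟩ 2 * α ∎)
        (subst (λ p → p * (w * w) ≤ 2 * (Z * Z)) (*-comm α (n ∸ α)) small)))

  -- Multiplicities are at most n for w ≤ Z / n and decay like 1 / w² beyond.
  ratios≤17Z : ∀ N → ∑[ w ∈ interval 1 N ] count (ratio? Z n w) n ≤ 17 * Z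
  ratios≤17Z N = begin
    -- The range is extended by `W` so that it can be cut at `W` without comparing `W` and `N`.
    ∑ (interval 1 N) g                                       ≤⟨ m≤m+n _ _ ⟩
    ∑ (interval 1 N) g + ∑ (interval (1 + N) W) g            ≡⟨ sym (∑-interval-+ 1 N W g) ⟩
    ∑ (interval 1 (N + W)) g                                 ≡⟨ cong (λ l → ∑ (interval 1 l) g) (+-comm N W) ⟩
    ∑ (interval 1 (W + N)) g                                 ≡⟨ ∑-interval-+ 1 W N g ⟩
    ∑ (interval 1 W) g + ∑ (interval (suc W) N) g            ≤⟨ +-mono-≤ near far ⟩
    Z + 2 * (8 * Z)                                          ≡⟨ e Z ⟩
    17 * Z                                                   ∎
    where
    open ≤-Reasoning
    W = Z ÷ n
    g : ℕ → ℕ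
    g w = count (ratio? Z n w) n
    T = ∑[ w ∈ interval (suc W) N ] (M ÷ (w * w))
    e : ∀ z → z + 2 * (8 * z) ≡ 17 * z
    e = solve-∀
    e′ : ∀ n m → n * (2 * m) ≡ 2 * (m * n)
    e′ = solve-∀
    e″ : ∀ z → 2 * (4 * (z * z)) ≡ 8 * z * z
    e″ = solve-∀
    near : ∑ (interval 1 W) g ≤ Z
    near = ≤-trans (∑-interval-≤ 1 W n g (λ {w} _ → count≤ (ratio? Z n w) n)) (÷-* Z n)
    T≤8Z : T ≤ 8 * Z
    T≤8Z = *-cancelʳ-≤ T (8 * Z) Z {{>-nonZero 1≤Z}} (begin
      T * Z                   ≤⟨ *-monoʳ-≤ T (<⇒≤ (<-÷ Z n 1≤n)) ⟩
      T * (suc W * n)         ≡⟨ trans (sym (*-assoc T (suc W) n)) (trans (*-comm _ n) (cong (n *_) (*-comm T (suc W)))) ⟩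
      n * (suc W * T)         ≤⟨ *-monoʳ-≤ n (inverse-square-tail M (suc W) N (s≤s z≤n)) ⟩
      n * (2 * M)             ≡⟨ e′ n M ⟩
      2 * (M * n)             ≤⟨ *-monoʳ-≤ 2 (÷-* (4 * (Z * Z)) n) ⟩
      2 * (4 * (Z * Z))       ≡⟨ e″ Z ⟩
      8 * Z * Z               ∎)
    far : ∑ (interval (suc W) N) g ≤ 2 * (8 * Z)
    far = begin
      ∑ (interval (suc W) N) g                               ≤⟨ ∑-mono (interval (suc W) N) (λ w∈ → multiplicity≤ (≤-trans (s≤s z≤n) (∈-interval⁻ (suc W) N w∈))) ⟩
      ∑[ w ∈ interval (suc W) N ] (2 * (M ÷ (w * w)))        ≡⟨ ∑-*ˡ (interval (suc W) N) 2 _ ⟩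
      2 * T                                                  ≤⟨ *-monoʳ-≤ 2 T≤8Z ⟩
      2 * (8 * Z)                                            ∎

-- Averages over all sequences of t options, i.e. the expectation of a random sequence
-- without the normalisation by length options ^ t.
module Choice {A : Set} (options : List A) (default : A) (default∈ : default ∈ options) where

  β : ℕ
  β = length options

  1≤β : 1 ≤ β
  1≤β = ∈-length default∈

  -- The default makes `get s i ∈ options` available for every `i`, not only below the length of
  -- `s`.
  get : List A → ℕ → A
  get []      _       = default
  get (c ∷ s) zero    = c
  get (c ∷ s) (suc i) = get s i

  E : ℕ → (List A → ℕ) → ℕ
  E zero    F = F []
  E (suc t) F = ∑[ c ∈ options ] E t (λ s → F (c ∷ s))

  E-mono : ∀ t {F G : List A → ℕ} → (∀ s → F s ≤ G s) → E t F ≤ E t G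
  E-mono zero    F≤G = F≤G []
  E-mono (suc t) F≤G = ∑-mono options (λ {c} _ → E-mono t (λ s → F≤G (c ∷ s)))

  E-∑ : ∀ t {B : Set} (xs : List B) (F : B → List A → ℕ) → E t (λ s → ∑[ x ∈ xs ] F x s) ≡ ∑[ x ∈ xs ] E t (F x)
  E-∑ zero    xs F = refl
  E-∑ (suc t) xs F = trans (∑-cong options (λ c → E-∑ t xs (λ x s → F x (c ∷ s))))
    (∑-swap options xs (λ c x → E t (λ s → F x (c ∷ s))))

  E-* : ∀ t k (F : List A → ℕ) → E t (λ s → k * F s) ≡ k * E t F
  E-* zero    k F = refl
  E-* (suc t) k F = trans (∑-cong options (λ c → E-* t k (λ s → F (c ∷ s)))) (∑-*ˡ options k _)

  E-1 : ∀ t → E t (λ _ → 1) ≡ β ^ t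
  E-1 zero    = refl
  E-1 (suc t) = trans (∑-cong options (λ _ → E-1 t)) (∑-const options (β ^ t))

  -- Method of conditional expectations: each option is fixed so that the average over the remaining
  -- choices does not exceed the previous one.
  derandomise : ∀ t F → ∃ λ s → (∀ i → get s i ∈ options) × β ^ t * F s ≤ E t F
  derandomise zero    F = [] , (λ _ → default∈) , ≤-reflexive (+-identityʳ (F []))
  derandomise (suc t) F with average options (λ c → E t (λ s → F (c ∷ s))) 1≤β
  ... | c , c∈ , c-avg with derandomise t (λ s → F (c ∷ s))
  ...   | s , s∈ , s-avg = c ∷ s , (λ { zero → c∈ ; (suc i) → s∈ i }) , (begin
      β * β ^ t * F (c ∷ s)            ≡⟨ *-assoc β (β ^ t) _ ⟩
      β * (β ^ t * F (c ∷ s))          ≤⟨ *-monoʳ-≤ β s-avg ⟩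
      β * E t (λ s → F (c ∷ s))        ≤⟨ c-avg ⟩
      E (suc t) F                      ∎)
    where open ≤-Reasoning

  -- Models an event satisfied by at most one option, hence of probability at most `1 / β`.
  Selects : (A → ℕ) → Set
  Selects g = ∑ options g ≤ 1

  private
    head-step : ∀ t g (G : List A → ℕ) → Selects g → E (suc t) (λ s → g (get s 0) * G (drop 1 s)) ≤ E t G
    head-step t g G sel = begin
      ∑[ c ∈ options ] E t (λ s → g c * G s)    ≡⟨ ∑-cong options (λ c → trans (E-* t (g c) G) (*-comm (g c) _)) ⟩
      ∑[ c ∈ options ] (E t G * g c)            ≡⟨ ∑-*ˡ options (E t G) g ⟩
      E t G * ∑ options g                       ≤⟨ *-monoʳ-≤ (E t G) sel ⟩
      E t G * 1                                 ≡⟨ *-identityʳ _ ⟩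
      E t G                                     ∎
      where open ≤-Reasoning

    shift-step : ∀ t k (G : List A → ℕ) → k * E t G ≤ β ^ t → k * ∑[ c ∈ options ] E t G ≤ β ^ suc t
    shift-step t k G ih = begin
      k * ∑[ c ∈ options ] E t G    ≡⟨ cong (k *_) (∑-const options (E t G)) ⟩
      k * (β * E t G)               ≡⟨ e k β (E t G) ⟩
      β * (k * E t G)               ≤⟨ *-monoʳ-≤ β ih ⟩
      β * β ^ t                     ∎
      where
      open ≤-Reasoning
      e : ∀ a b c → a * (b * c) ≡ b * (a * c)
      e = solve-∀

    absorb : ∀ t k {X Y} → X ≤ Y → k * Y ≤ β ^ t → β * k * X ≤ β ^ suc t
    absorb t k {X} {Y} X≤Y kY≤ = begin
      β * k * X      ≡⟨ *-assoc β k X ⟩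
      β * (k * X)    ≤⟨ *-monoʳ-≤ β (≤-trans (*-monoʳ-≤ k X≤Y) kY≤) ⟩
      β * β ^ t      ∎
      where open ≤-Reasoning

  -- The factor is written `β * 1` so that three of them stack definitionally to `β ^ 3`.
  E-one : ∀ t l g → l < t → Selects g → β * 1 * E t (λ s → g (get s l)) ≤ β ^ t
  E-one (suc t) zero    g _ sel =
    absorb t 1 (≤-trans (E-mono (suc t) (λ s → ≤-reflexive (sym (*-identityʳ (g (get s 0)))))) (head-step t g (λ _ → 1) sel))
      (≤-reflexive (trans (+-identityʳ _) (E-1 t)))
  E-one (suc t) (suc l) g (s≤s l<t) sel = shift-step t (β * 1) _ (E-one t l g l<t sel)

  E-two : ∀ t j l g h → j < l → l < t → Selects g → Selects h →
    β * (β * 1) * E t (λ s → g (get s j) * h (get s l)) ≤ β ^ t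
  E-two (suc t) zero    (suc l) g h _ (s≤s l<t) sel-g sel-h =
    absorb t (β * 1) (head-step t g (λ s → h (get s l)) sel-g) (E-one t l h l<t sel-h)
  E-two (suc t) (suc j) (suc l) g h (s≤s j<l) (s≤s l<t) sel-g sel-h =
    shift-step t (β * (β * 1)) _ (E-two t j l g h j<l l<t sel-g sel-h)

  -- Independence of three distinct choices. The sequence is read from the front: a tested index
  -- gains a factor `1 / β`, a skipped one changes nothing.
  E-three : ∀ t i j l f g h → i < j → j < l → l < t → Selects f → Selects g → Selects h →
    β ^ 3 * E t (λ s → f (get s i) * (g (get s j) * h (get s l))) ≤ β ^ t
  E-three (suc t) zero    (suc j) (suc l) f g h _ (s≤s j<l) (s≤s l<t) sel-f sel-g sel-h =
    absorb t (β * (β * 1)) (head-step t f (λ s → g (get s j) * h (get s l)) sel-f) (E-two t j l g h j<l l<t sel-g sel-h)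
  E-three (suc t) (suc i) (suc j) (suc l) f g h (s≤s i<j) (s≤s j<l) (s≤s l<t) sel-f sel-g sel-h =
    shift-step t (β ^ 3) _ (E-three t i j l f g h i<j j<l l<t sel-f sel-g sel-h)

-- Collinear triples near a parabola

-- Divide by `w = gcd a D`: `α` and `n` become coprime, so `α f = e n` forces `n` to divide `f`. It
-- is the pair `(α , n)` that is reduced, not the vector `(w , w₂)`.
primitive-step : ∀ a D e f → 1 ≤ a → a < D → a * f ≡ e * D →
  ∃ λ n → ∃ λ w → ∃ λ α → ∃ λ w₂ →
    1 ≤ α × α < n × 1 ≤ w × a ≡ α * w × D ≡ n * w × e ≡ α * w₂ × f ≡ n * w₂
primitive-step a D e f 1≤a a<D af≡eD = n , g , α , w₂ , 1≤α , α<n , >-nonZero⁻¹ g , a≡ , D≡ , e≡ , f≡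
  where
  open ≡-Reasoning
  g = gcd a D
  instance
    g≢0 : NonZero g
    g≢0 = ≢-nonZero (gcd[m,n]≢0 a D (inj₁ (m<n⇒n≢0 1≤a)))
  α = a / g
  n = D / g
  a≡ : a ≡ α * g
  a≡ = sym (m/n*n≡m (gcd[m,n]∣m a D))
  D≡ : D ≡ n * g
  D≡ = sym (m/n*n≡m (gcd[m,n]∣n a D))
  α<n : α < n
  α<n = *-cancelʳ-< g α n (subst₂ _<_ a≡ D≡ a<D)
  1≤α : 1 ≤ α
  1≤α = *-cancelʳ-< g 0 α (subst (0 <_) a≡ 1≤a)
  αf≡en : α * f ≡ e * n
  αf≡en = *-cancelʳ-≡ (α * f) (e * n) g (begin
    α * f * g      ≡⟨ e₁ α f g ⟩
    α * g * f      ≡⟨ cong (_* f) (sym a≡) ⟩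
    a * f          ≡⟨ af≡eD ⟩
    e * D          ≡⟨ cong (e *_) D≡ ⟩
    e * (n * g)    ≡⟨ sym (*-assoc e n g) ⟩
    e * n * g      ∎)
    where
    e₁ : ∀ a b c → a * b * c ≡ a * c * b
    e₁ = solve-∀
  n∣f : n ∣ f
  n∣f = coprime-divisor (coprime-sym (coprime-/gcd a D)) (subst (n ∣_) (sym αf≡en) (n∣m*n e))
  w₂ = _∣_.quotient n∣f
  f≡ : f ≡ n * w₂
  f≡ = trans (_∣_.equality n∣f) (*-comm w₂ n)
  e≡ : e ≡ α * w₂
  e≡ = *-cancelʳ-≡ e (α * w₂) n {{>-nonZero (≤-trans (s≤s z≤n) α<n)}} (begin
    e * n          ≡⟨ sym αf≡en ⟩
    α * f          ≡⟨ cong (α *_) f≡ ⟩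
    α * (n * w₂)   ≡⟨ e₁ α n w₂ ⟩
    α * w₂ * n     ∎)
    where
    e₁ : ∀ a b c → a * (b * c) ≡ a * c * b
    e₁ = solve-∀

-- | A y − A x − x² | ≤ A b: the points within vertical distance b of a parabola.
Strip : ℕ → ℕ → ℕ → ℕ → Set
Strip A b x y = A * x + x * x ≤ A * y + A * b × A * y ≤ A * x + x * x + A * b

-- Weigh the three points by `n − α`, `−n` and `α`: affine functions cancel, the square leaves
-- `n α (n − α) w²`, and the strip errors add up to `2 n A b`.
curvature : ∀ A b x y n α w w₂ → α < n → Strip A b x y → Strip A b (x + α * w) (y + α * w₂) →
  Strip A b (x + n * w) (y + n * w₂) → α * (n ∸ α) * (w * w) ≤ 2 * (A * b)
curvature A b x y n α w w₂ α<n (P≥ , _) (_ , Q≤) (R≥ , _) =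
  go (n ∸ α) (m+[n∸m]≡n (<⇒≤ α<n)) (>-nonZero (≤-trans (s≤s z≤n) α<n)) R≥
  where
  open ≤-Reasoning
  go : ∀ γ → α + γ ≡ n → NonZero n → A * (x + n * w) + (x + n * w) * (x + n * w) ≤ A * (y + n * w₂) + A * b →
    α * γ * (w * w) ≤ 2 * (A * b)
  go γ refl n≢0 R≥ = *-cancelˡ-≤ (α + γ) {{n≢0}} (+-cancelˡ-≤ common _ _ (begin
    common + (α + γ) * (α * γ * (w * w))
      ≡⟨ sym (e₁ A α γ w w₂ x y) ⟩
    (α + γ) * (A * (y + α * w₂)) + γ * (A * x + x * x) + α * (A * (x + (α + γ) * w) + (x + (α + γ) * w) * (x + (α + γ) * w))
      ≤⟨ +-mono-≤ (+-mono-≤ (*-monoʳ-≤ (α + γ) Q≤) (*-monoʳ-≤ γ P≥)) (*-monoʳ-≤ α R≥) ⟩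
    (α + γ) * (A * (x + α * w) + (x + α * w) * (x + α * w) + A * b) + γ * (A * y + A * b) + α * (A * (y + (α + γ) * w₂) + A * b)
      ≡⟨ e₂ A b α γ w w₂ x y ⟩
    common + (α + γ) * (2 * (A * b)) ∎))
    where
    common = (α + γ) * (A * (x + α * w) + (x + α * w) * (x + α * w)) + γ * (A * y) + α * (A * (y + (α + γ) * w₂))
    e₁ : ∀ A α γ w w₂ x y →
      (α + γ) * (A * (y + α * w₂)) + γ * (A * x + x * x) + α * (A * (x + (α + γ) * w) + (x + (α + γ) * w) * (x + (α + γ) * w))
      ≡ (α + γ) * (A * (x + α * w) + (x + α * w) * (x + α * w)) + γ * (A * y) + α * (A * (y + (α + γ) * w₂)) + (α + γ) * (α * γ * (w * w))
    e₁ = solve-∀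
    e₂ : ∀ A b α γ w w₂ x y →
      (α + γ) * (A * (x + α * w) + (x + α * w) * (x + α * w) + A * b) + γ * (A * y + A * b) + α * (A * (y + (α + γ) * w₂) + A * b)
      ≡ (α + γ) * (A * (x + α * w) + (x + α * w) * (x + α * w)) + γ * (A * y) + α * (A * (y + (α + γ) * w₂)) + (α + γ) * (2 * (A * b))
    e₂ = solve-∀

-- The abscissae at which a vector (D , f) can join two points of the strip.
Near : ℕ → ℕ → ℕ → ℕ → ℕ → Set
Near A b D f x = A * f ≤ A * D + 2 * D * x + D * D + 2 * (A * b) × A * D + 2 * D * x + D * D ≤ A * f + 2 * (A * b)

near? : ∀ A b D f x → Dec (Near A b D f x)
near? A b D f x = A * f ≤? A * D + 2 * D * x + D * D + 2 * (A * b) ×-dec A * D + 2 * D * x + D * D ≤? A * f + 2 * (A * b)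

-- Subtracting the two strip conditions, each off by at most `A b`, eliminates `y` and leaves a
-- condition on the abscissa alone.
near : ∀ A b x y D f → Strip A b x y → Strip A b (x + D) (y + f) → Near A b D f x
near A b x y D f (P≥ , P≤) (R≥ , R≤) =
  +-cancelˡ-≤ (A * y + A * x + x * x) _ _ (subst₂ _≤_ (e₁ A x y f) (e₂ A b x y D) (+-mono-≤ R≤ P≥)) ,
  +-cancelˡ-≤ (A * y + A * x + x * x) _ _ (subst₂ _≤_ (e₃ A x y D) (e₄ A b x y f) (+-mono-≤ R≥ P≤))
  where
  e₁ : ∀ A x y f → A * (y + f) + (A * x + x * x) ≡ A * y + A * x + x * x + A * f
  e₁ = solve-∀
  e₂ : ∀ A b x y D → A * (x + D) + (x + D) * (x + D) + A * b + (A * y + A * b) ≡ A * y + A * x + x * x + (A * D + 2 * D * x + D * D + 2 * (A * b))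
  e₂ = solve-∀
  e₃ : ∀ A x y D → A * (x + D) + (x + D) * (x + D) + A * y ≡ A * y + A * x + x * x + (A * D + 2 * D * x + D * D)
  e₃ = solve-∀
  e₄ : ∀ A b x y f → A * (y + f) + A * b + (A * x + x * x + A * b) ≡ A * y + A * x + x * x + (A * f + 2 * (A * b))
  e₄ = solve-∀

-- One from the linear term of the curve, two from the derivative `2 x / A` on `[0, A]`, two from
-- the strip width because `b ≤ D`. This makes the range of `w₂` finite.
slope≤5 : ∀ A b D f x .{{_ : NonZero A}} → Near A b D f x → x + D ≤ A → b ≤ D → f ≤ 5 * D
slope≤5 A b D f x (f≤ , _) x+D≤A b≤D = *-cancelˡ-≤ A (begin
  A * f                                           ≤⟨ f≤ ⟩
  A * D + 2 * D * x + D * D + 2 * (A * b)         ≤⟨ m≤m+n _ (D * D) ⟩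
  A * D + 2 * D * x + D * D + 2 * (A * b) + D * D ≡⟨ e₁ A b D x ⟩
  A * D + 2 * (D * (x + D)) + 2 * (A * b)         ≤⟨ +-mono-≤ (+-monoʳ-≤ (A * D) (*-monoʳ-≤ 2 (*-monoʳ-≤ D x+D≤A))) (*-monoʳ-≤ 2 (*-monoʳ-≤ A b≤D)) ⟩
  A * D + 2 * (D * A) + 2 * (A * D)               ≡⟨ e₂ A D ⟩
  A * (5 * D)                                     ∎)
  where
  open ≤-Reasoning
  e₁ : ∀ A b D x → A * D + 2 * D * x + D * D + 2 * (A * b) + D * D ≡ A * D + 2 * (D * (x + D)) + 2 * (A * b)
  e₁ = solve-∀
  e₂ : ∀ A D → A * D + 2 * (D * A) + 2 * (A * D) ≡ A * (5 * D)
  e₂ = solve-∀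

-- Between two such abscissae the term `2 D x` changes by at most `4 A b`.
near-count : ∀ A b D f N → 1 ≤ D → count (near? A b D f) N ≤ suc (2 * (A * b) ÷ D)
near-count A b D f N 1≤D = count-spread (near? A b D f) N (2 * (A * b) ÷ D) spread
  where
  open ≤-Reasoning
  spread : ∀ {x x′} → x ≤ x′ → Near A b D f x → Near A b D f x′ → x′ ≤ x + 2 * (A * b) ÷ D
  spread {x} {x′} x≤x′ (f≤ , _) (_ , ≤f) = ≤-trans (m≤n+m∸n x′ x) (+-monoʳ-≤ x (≤-÷ 1≤D (*-cancelˡ-≤ 2
    (+-cancelˡ-≤ (A * D + 2 * D * x + D * D) _ _ (begin
      A * D + 2 * D * x + D * D + 2 * ((x′ ∸ x) * D)            ≡⟨ e₁ A D x (x′ ∸ x) ⟩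
      A * D + 2 * D * (x + (x′ ∸ x)) + D * D                    ≡⟨ cong (λ z → A * D + 2 * D * z + D * D) (m+[n∸m]≡n x≤x′) ⟩
      A * D + 2 * D * x′ + D * D                                ≤⟨ ≤f ⟩
      A * f + 2 * (A * b)                                       ≤⟨ +-monoˡ-≤ (2 * (A * b)) f≤ ⟩
      A * D + 2 * D * x + D * D + 2 * (A * b) + 2 * (A * b)     ≡⟨ e₂ (A * D + 2 * D * x + D * D) (A * b) ⟩
      A * D + 2 * D * x + D * D + 2 * (2 * (A * b))             ∎)))))
    where
    e₁ : ∀ A D x d → A * D + 2 * D * x + D * D + 2 * (d * D) ≡ A * D + 2 * D * (x + d) + D * D
    e₁ = solve-∀
    e₂ : ∀ a b → a + 2 * b + 2 * b ≡ a + 2 * (2 * b)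
    e₂ = solve-∀

collinear⇒ℕ : ∀ x y {a D e f} → Collinear (x , y) (x + a , y + e) (x + D , y + f) → a * f ≡ e * D
collinear⇒ℕ x y {a} {D} {e} {f} coll = ℤ.+-injective (begin
  ℤ.+ (a * f)                                                                     ≡⟨ ℤ.pos-* a f ⟩
  ℤ.+ a ℤ.* ℤ.+ f                                                                 ≡⟨ sym (cong₂ ℤ._*_ (gap x a) (gap y f)) ⟩
  (ℤ.+ (x + a) ℤ.- ℤ.+ x) ℤ.* (ℤ.+ (y + f) ℤ.- ℤ.+ y)                             ≡⟨ coll ⟩
  (ℤ.+ (y + e) ℤ.- ℤ.+ y) ℤ.* (ℤ.+ (x + D) ℤ.- ℤ.+ x)                             ≡⟨ cong₂ ℤ._*_ (gap y e) (gap x D) ⟩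
  ℤ.+ e ℤ.* ℤ.+ D                                                                 ≡⟨ sym (ℤ.pos-* e D) ⟩
  ℤ.+ (e * D)                                                                     ∎)
  where
  open ≡-Reasoning
  cancel : ∀ m n → (m ℤ.+ n) ℤ.- m ≡ n
  cancel = ℤ-solve-∀
  gap : ∀ m n → ℤ.+ (m + n) ℤ.- ℤ.+ m ≡ ℤ.+ n
  gap m n = cancel (ℤ.+ m) (ℤ.+ n)

collinear-swap₂₃ : ∀ u v w → Collinear u v w → Collinear u w v
collinear-swap₂₃ u v w coll = trans (ℤ.*-comm (xc w ℤ.- xc u) _) (trans (sym coll) (ℤ.*-comm (xc v ℤ.- xc u) _))

collinear-swap₁₂ : ∀ u v w → Collinear u v w → Collinear v u w
collinear-swap₁₂ u v w coll = begin
    (a ℤ.- c) ℤ.* (f ℤ.- d)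
      ≡⟨ e₁ a b c d e f ⟩
    (b ℤ.- d) ℤ.* (e ℤ.- c) ℤ.+ ((d ℤ.- b) ℤ.* (e ℤ.- a) ℤ.- (c ℤ.- a) ℤ.* (f ℤ.- b))
      ≡⟨ cong (λ z → (b ℤ.- d) ℤ.* (e ℤ.- c) ℤ.+ ((d ℤ.- b) ℤ.* (e ℤ.- a) ℤ.- z)) coll ⟩
    (b ℤ.- d) ℤ.* (e ℤ.- c) ℤ.+ ((d ℤ.- b) ℤ.* (e ℤ.- a) ℤ.- (d ℤ.- b) ℤ.* (e ℤ.- a))
      ≡⟨ e₂ ((b ℤ.- d) ℤ.* (e ℤ.- c)) ((d ℤ.- b) ℤ.* (e ℤ.- a)) ⟩
    (b ℤ.- d) ℤ.* (e ℤ.- c) ∎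
  where
  open ≡-Reasoning
  a = xc u ; b = yc u ; c = xc v ; d = yc v ; e = xc w ; f = yc w
  e₁ : ∀ a b c d e f → (a ℤ.- c) ℤ.* (f ℤ.- d) ≡
    (b ℤ.- d) ℤ.* (e ℤ.- c) ℤ.+ ((d ℤ.- b) ℤ.* (e ℤ.- a) ℤ.- (c ℤ.- a) ℤ.* (f ℤ.- b))
  e₁ = ℤ-solve-∀
  e₂ : ∀ p q → p ℤ.+ (q ℤ.- q) ≡ p
  e₂ = ℤ-solve-∀

-- The random selection: one point in each block along the parabola

module Construction (b t A Z J : ℕ) .{{_ : NonZero b}} .{{_ : NonZero A}} (1≤Z : 1 ≤ Z)
  (A≡bt : A ≡ b * t) (Z²≡Ab : Z * Z ≡ A * b) (A≤2^J : A ≤ 2 ^ J) where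

  options : List (ℕ × ℕ)
  options = cartesianProduct (downFrom b) (downFrom b)

  options-unique : Unique options
  options-unique = Unique.cartesianProduct⁺ (Unique.downFrom⁺ b) (Unique.downFrom⁺ b)

  options-bound : ∀ {c} → c ∈ options → proj₁ c < b × proj₂ c < b
  options-bound c∈ with u∈ , v∈ ← ∈-cartesianProduct⁻ (downFrom b) (downFrom b) c∈ = ∈-downFrom⁻ u∈ , ∈-downFrom⁻ v∈

  0<b : 0 < b
  0<b = >-nonZero⁻¹ b

  open Choice options (0 , 0) (∈-cartesianProduct⁺ (∈-downFrom⁺ 0<b) (∈-downFrom⁺ 0<b)) public

  ∑-options : ∀ (g : ℕ → ℕ) → ∑[ c ∈ options ] g (proj₁ c) ≡ b * ∑ (downFrom b) g
  ∑-options g = begin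
    ∑[ c ∈ options ] g (proj₁ c)                     ≡⟨ ∑-cartesianProduct (downFrom b) (downFrom b) (λ c → g (proj₁ c)) ⟩
    ∑[ u ∈ downFrom b ] ∑[ v ∈ downFrom b ] g u      ≡⟨ ∑-cong (downFrom b) (λ u → trans (∑-const (downFrom b) (g u)) (cong (_* g u) (length-downFrom b))) ⟩
    ∑[ u ∈ downFrom b ] (b * g u)                    ≡⟨ ∑-*ˡ (downFrom b) b g ⟩
    b * ∑ (downFrom b) g                             ∎
    where open ≡-Reasoning

  β≡b² : β ≡ b * b
  β≡b² = begin
    length options                          ≡⟨ sym (trans (∑-const options 1) (*-identityʳ _)) ⟩
    ∑[ c ∈ options ] 1                      ≡⟨ ∑-options (λ _ → 1) ⟩
    b * ∑[ u ∈ downFrom b ] 1               ≡⟨ cong (b *_) (trans (∑-const (downFrom b) 1) (trans (*-identityʳ _) (length-downFrom b))) ⟩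
    b * b                                   ∎
    where open ≡-Reasoning

  abscissa : ℕ → ℕ × ℕ → ℕ
  abscissa i c = b * i + proj₁ c

  -- The linear term is `b * i` and not the abscissa: its jump by `b` from block to block absorbs
  -- the vertical offset, which is below `b`, so every selection is monotone; the points still stay
  -- in the strip.
  point : ℕ → ℕ × ℕ → Point
  point i c = abscissa i c , b * i + abscissa i c * abscissa i c / A + proj₂ c

  point-injective : ∀ i {c c′} → point i c ≡ point i c′ → c ≡ c′
  point-injective i {u , v} {u′ , v′} eq with +-cancelˡ-≡ (b * i) u u′ (,-injectiveˡ eq)
  ... | refl = cong (u ,_) (+-cancelˡ-≡ _ v v′ (,-injectiveʳ eq))

  block : ∀ i {c} → proj₁ c < b → abscissa i c / b ≡ i
  block i {u , v} u<b = begin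
    (b * i + u) / b          ≡⟨ cong (λ z → (z + u) / b) (*-comm b i) ⟩
    (i * b + u) / b          ≡⟨ +-distrib-/-∣ˡ {i * b} u (n∣m*n i) ⟩
    i * b / b + u / b        ≡⟨ cong₂ _+_ (m*n/n≡m i b) (m<n⇒m/n≡0 u<b) ⟩
    i + 0                    ≡⟨ +-identityʳ i ⟩
    i                        ∎
    where open ≡-Reasoning

  abscissa-step : ∀ {i j c d} → proj₁ c < b → i < j → abscissa i c < b * suc i × b * suc i ≤ abscissa j d
  abscissa-step {i} {j} {c} u<b i<j =
    subst (abscissa i c <_) (trans (+-comm (b * i) b) (sym (*-suc b i))) (+-monoʳ-< (b * i) u<b) ,
    ≤-trans (*-monoʳ-≤ b i<j) (m≤m+n (b * j) _)

  abscissa-< : ∀ {i j c d} → proj₁ c < b → i < j → abscissa i c < abscissa j d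
  abscissa-< {c = c} {d} u<b i<j with x< , ≤x ← abscissa-step {c = c} {d} u<b i<j = <-≤-trans x< ≤x

  abscissa<A : ∀ {i c} → proj₁ c < b → i < t → abscissa i c < A
  abscissa<A {i} {c} u<b i<t with x< , _ ← abscissa-step {c = c} {c} u<b i<t =
    <-≤-trans x< (subst (b * suc i ≤_) (sym A≡bt) (*-monoʳ-≤ b i<t))

  ordinate-≤ : ∀ {i j c d} → proj₁ c < b → proj₂ c < b → i < j → proj₂ (point i c) ≤ proj₂ (point j d)
  ordinate-≤ {i} {j} {c} {d} u<b v<b i<j = begin
    b * i + x * x / A + proj₂ c         ≤⟨ +-mono-≤ (+-monoʳ-≤ (b * i) (/-monoˡ-≤ A (*-mono-≤ x≤x′ x≤x′))) (<⇒≤ v<b) ⟩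
    b * i + x′ * x′ / A + b             ≡⟨ e (b * i) (x′ * x′ / A) b ⟩
    b + b * i + x′ * x′ / A             ≡⟨ cong (_+ x′ * x′ / A) (sym (*-suc b i)) ⟩
    b * suc i + x′ * x′ / A             ≤⟨ +-monoˡ-≤ _ (*-monoʳ-≤ b i<j) ⟩
    b * j + x′ * x′ / A                 ≤⟨ m≤m+n _ (proj₂ d) ⟩
    b * j + x′ * x′ / A + proj₂ d       ∎
    where
    open ≤-Reasoning
    x = abscissa i c
    x′ = abscissa j d
    x≤x′ = <⇒≤ (abscissa-< {c = c} {d = d} u<b i<j)
    e : ∀ a b c → a + b + c ≡ c + a + b
    e = solve-∀

  strip : ∀ i {c} → proj₁ c < b → proj₂ c < b → Strip A b (abscissa i c) (proj₂ (point i c))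
  strip i {u , v} u<b v<b = lower , upper
    where
    open ≤-Reasoning
    x = b * i + u
    q = x * x / A
    e₁ : ∀ A B u q v → A * (B + u) + (A + q * A) + A * v ≡ A * (B + q + v) + A * suc u
    e₁ = solve-∀
    lower : A * x + x * x ≤ A * (b * i + q + v) + A * b
    lower = begin
      A * x + x * x                              ≡⟨ cong (λ z → A * x + z) (m≡m%n+[m/n]*n (x * x) A) ⟩
      A * x + (x * x % A + q * A)                ≤⟨ +-monoʳ-≤ (A * x) (+-monoˡ-≤ (q * A) (m%n≤n (x * x) A)) ⟩
      A * x + (A + q * A)                        ≤⟨ m≤m+n _ (A * v) ⟩
      A * (b * i + u) + (A + q * A) + A * v      ≡⟨ e₁ A (b * i) u q v ⟩
      A * (b * i + q + v) + A * suc u            ≤⟨ +-monoʳ-≤ _ (*-monoʳ-≤ A u<b) ⟩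
      A * (b * i + q + v) + A * b                ∎
    e₂ : ∀ A B q v → A * (B + q + v) ≡ A * B + q * A + A * v
    e₂ = solve-∀
    upper : A * (b * i + q + v) ≤ A * x + x * x + A * b
    upper = begin
      A * (b * i + q + v)                        ≡⟨ e₂ A (b * i) q v ⟩
      A * (b * i) + q * A + A * v                ≤⟨ +-mono-≤ (+-mono-≤ (*-monoʳ-≤ A (m≤m+n (b * i) u)) (m/n*n≤m (x * x) A)) (*-monoʳ-≤ A (<⇒≤ v<b)) ⟩
      A * x + x * x + A * b                      ∎

  Params : Set
  Params = ((ℕ × ℕ) × ℕ) × ℕ

  params : List Params
  params = dyadic J ⊗ (λ _ → interval 1 A) ⊗ (λ (n , _) → downFrom n) ⊗ (λ ((_ , w) , _) → downFrom (suc (5 * w)))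

  -- The block inequalities put the three points into distinct blocks, as independence requires. The
  -- other conditions hold for every collinear triple of a selection and keep the count small.
  Admissible : ℕ → ℕ × ℕ → Params → Set
  Admissible i c (((n , w) , α) , w₂) =
    (i < (x + α * w) / b × (x + α * w) / b < (x + n * w) / b × (x + n * w) / b < t) ×
    Ratio Z n w α × n * w ≤ A × Near A b (n * w) (n * w₂) x
    where x = abscissa i c

  admissible? : ∀ i c τ → Dec (Admissible i c τ)
  admissible? i c (((n , w) , α) , w₂) =
    (i <? (x + α * w) / b ×-dec (x + α * w) / b <? (x + n * w) / b ×-dec (x + n * w) / b <? t) ×-dec
    ratio? Z n w α ×-dec n * w ≤? A ×-dec near? A b (n * w) (n * w₂) x
    where x = abscissa i c

  _≟ₚ_ : (p q : ℕ × ℕ) → Dec (p ≡ q)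
  _≟ₚ_ = ×-≡-dec _≟_ _≟_

  -- A point `p` can only be selected in the block `proj₁ p / b`, so its selection depends on a
  -- single choice.
  hits : Point → ℕ × ℕ → ℕ
  hits p c = 𝟙 (point (proj₁ p / b) c ≟ₚ p)

  hits-selects : ∀ p → Selects (hits p)
  hits-selects p = atMostOne (λ c → point (proj₁ p / b) c ≟ₚ p) options-unique
    (λ _ _ ec ed c≢d → c≢d (point-injective (proj₁ p / b) (trans ec (sym ed))))

  equals-selects : ∀ c → Selects (λ c′ → 𝟙 (c′ ≟ₚ c))
  equals-selects c = atMostOne (_≟ₚ c) options-unique (λ _ _ ec ed c≢d → c≢d (trans ec (sym ed)))

  translate : Point → ℕ → ℕ → ℕ → Point
  translate p m w w₂ = proj₁ p + m * w , proj₂ p + m * w₂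

  at : List (ℕ × ℕ) → Point → ℕ
  at s p = hits p (get s (proj₁ p / b))

  occurs : ℕ → ℕ × ℕ → Params → List (ℕ × ℕ) → ℕ
  occurs i c (((n , w) , α) , w₂) s =
    𝟙 (get s i ≟ₚ c) * (at s (translate (point i c) α w w₂) * at s (translate (point i c) n w w₂))

  E-occurs : ∀ i c τ → β ^ 3 * E t (λ s → 𝟙 (admissible? i c τ) * occurs i c τ s) ≤ 𝟙 (admissible? i c τ) * β ^ t
  E-occurs i c τ@(((n , w) , α) , w₂) = begin
    β ^ 3 * E t (λ s → 𝟙 (admissible? i c τ) * occurs i c τ s)     ≡⟨ cong (β ^ 3 *_) (E-* t (𝟙 (admissible? i c τ)) (occurs i c τ)) ⟩
    β ^ 3 * (𝟙 (admissible? i c τ) * E t (occurs i c τ))           ≡⟨ e (β ^ 3) (𝟙 (admissible? i c τ)) (E t (occurs i c τ)) ⟩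
    𝟙 (admissible? i c τ) * (β ^ 3 * E t (occurs i c τ))           ≤⟨ restrict (admissible? i c τ) ⟩
    𝟙 (admissible? i c τ) * β ^ t                                  ∎
    where
    open ≤-Reasoning
    e : ∀ a b c → a * (b * c) ≡ b * (a * c)
    e = solve-∀
    restrict : (d : Dec (Admissible i c τ)) → 𝟙 d * (β ^ 3 * E t (occurs i c τ)) ≤ 𝟙 d * β ^ t
    restrict (no _) = z≤n
    restrict (yes ((i<j , j<l , l<t) , _)) = *-monoʳ-≤ 1
      (E-three t i _ _ _ _ _ i<j j<l l<t (equals-selects c) (hits-selects _) (hits-selects _))

  -- Collinear triples are charged to their leftmost point, so deleting the points with a nonzero
  -- charge destroys all of them.
  bad : ℕ → List (ℕ × ℕ) → ℕ
  bad i s = ∑[ c ∈ options ] ∑[ τ ∈ params ] (𝟙 (admissible? i c τ) * occurs i c τ s)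

  total : ℕ
  total = ∑[ i ∈ downFrom t ] ∑[ c ∈ options ] ∑[ τ ∈ params ] 𝟙 (admissible? i c τ)

  E-bad : β ^ 3 * E t (λ s → ∑[ i ∈ downFrom t ] bad i s) ≤ total * β ^ t
  E-bad = begin
    β ^ 3 * E t (λ s → ∑[ i ∈ downFrom t ] bad i s)
      ≡⟨ cong (β ^ 3 *_) expand ⟩
    β ^ 3 * ∑[ i ∈ downFrom t ] ∑[ c ∈ options ] ∑[ τ ∈ params ] E t (λ s → 𝟙 (admissible? i c τ) * occurs i c τ s)
      ≡⟨ push (β ^ 3) (λ i c τ → E t (λ s → 𝟙 (admissible? i c τ) * occurs i c τ s)) ⟩
    ∑[ i ∈ downFrom t ] ∑[ c ∈ options ] ∑[ τ ∈ params ] (β ^ 3 * E t (λ s → 𝟙 (admissible? i c τ) * occurs i c τ s))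
      ≤⟨ ∑-mono (downFrom t) (λ {i} _ → ∑-mono options (λ {c} _ → ∑-mono params (λ {τ} _ → bound i c τ))) ⟩
    ∑[ i ∈ downFrom t ] ∑[ c ∈ options ] ∑[ τ ∈ params ] (β ^ t * 𝟙 (admissible? i c τ))
      ≡⟨ sym (push (β ^ t) (λ i c τ → 𝟙 (admissible? i c τ))) ⟩
    β ^ t * total
      ≡⟨ *-comm (β ^ t) total ⟩
    total * β ^ t ∎
    where
    open ≤-Reasoning
    bound : ∀ i c τ → β ^ 3 * E t (λ s → 𝟙 (admissible? i c τ) * occurs i c τ s) ≤ β ^ t * 𝟙 (admissible? i c τ)
    bound i c τ = ≤-trans (E-occurs i c τ) (≤-reflexive (*-comm (𝟙 (admissible? i c τ)) (β ^ t)))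
    expand : E t (λ s → ∑[ i ∈ downFrom t ] bad i s) ≡
      ∑[ i ∈ downFrom t ] ∑[ c ∈ options ] ∑[ τ ∈ params ] E t (λ s → 𝟙 (admissible? i c τ) * occurs i c τ s)
    expand = trans (E-∑ t (downFrom t) bad) (∑-cong (downFrom t) λ i →
      trans (E-∑ t options (λ c s → ∑[ τ ∈ params ] (𝟙 (admissible? i c τ) * occurs i c τ s))) (∑-cong options λ c →
        E-∑ t params (λ τ s → 𝟙 (admissible? i c τ) * occurs i c τ s)))
    push : ∀ k (g : ℕ → ℕ × ℕ → Params → ℕ) → k * ∑[ i ∈ downFrom t ] ∑[ c ∈ options ] ∑[ τ ∈ params ] g i c τ
      ≡ ∑[ i ∈ downFrom t ] ∑[ c ∈ options ] ∑[ τ ∈ params ] (k * g i c τ)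
    push k g = sym (trans (∑-cong (downFrom t) λ i → trans (∑-cong options λ c → ∑-*ˡ params k (g i c)) (∑-*ˡ options k _))
      (∑-*ˡ (downFrom t) k _))

  never⇒≤ : ∀ n w α w₂ {m} → (∀ i c → ¬ Admissible i c (((n , w) , α) , w₂)) →
    ∑[ i ∈ downFrom t ] ∑[ c ∈ options ] 𝟙 (admissible? i c (((n , w) , α) , w₂)) ≤ m
  never⇒≤ n w α w₂ never = ≤-trans (≤-reflexive (trans (∑-cong (downFrom t) λ i → trans (∑-cong options λ c →
    𝟙-no (admissible? i c (((n , w) , α) , w₂)) (never i c)) (∑-0 options)) (∑-0 (downFrom t)))) z≤n

  -- For a fixed step only the abscissa of the first point is constrained: the blocks tile
  -- `[0, b t)`, `near-count` bounds the abscissae, and each comes with `b` vertical offsets.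
  joins≤ : ∀ n w α w₂ → 1 ≤ n → 1 ≤ w →
    ∑[ i ∈ downFrom t ] ∑[ c ∈ options ] 𝟙 (admissible? i c (((n , w) , α) , w₂)) ≤
    𝟙 (ratio? Z n w α) * (b * (3 * (Z * Z) ÷ (n * w)))
  joins≤ n w α w₂ 1≤n 1≤w = cases (ratio? Z n w α) (n * w ≤? A)
    where
    open ≤-Reasoning
    D = n * w
    1≤D : 1 ≤ D
    1≤D = *-mono-≤ 1≤n 1≤w
    g : ℕ → ℕ
    g x = 𝟙 (near? A b D (n * w₂) x)
    -- The extra 1 of `near-count` is absorbed through `D ≤ A ≤ A b`.
    count≤3Z² : n * w ≤ A → suc (2 * (A * b) ÷ D) * D ≤ 3 * (Z * Z)
    count≤3Z² nw≤A = begin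
      D + 2 * (A * b) ÷ D * D    ≤⟨ +-mono-≤ nw≤A (÷-* (2 * (A * b)) D) ⟩
      A + 2 * (A * b)            ≤⟨ +-monoˡ-≤ (2 * (A * b)) (m≤m*n A b) ⟩
      3 * (A * b)                ≡⟨ cong (3 *_) (sym Z²≡Ab) ⟩
      3 * (Z * Z)                ∎
    cases : (d : Dec (Ratio Z n w α)) → Dec (n * w ≤ A) →
      ∑[ i ∈ downFrom t ] ∑[ c ∈ options ] 𝟙 (admissible? i c (((n , w) , α) , w₂)) ≤ 𝟙 d * (b * (3 * (Z * Z) ÷ (n * w)))
    cases (no ¬ratio) _         = never⇒≤ n w α w₂ (λ i c (_ , ratio , _) → ¬ratio ratio)
    cases (yes _)     (no nw≰A) = never⇒≤ n w α w₂ (λ i c (_ , _ , nw≤A , _) → nw≰A nw≤A)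
    cases (yes _)     (yes nw≤A) = begin
      ∑[ i ∈ downFrom t ] ∑[ c ∈ options ] 𝟙 (admissible? i c (((n , w) , α) , w₂))
        ≤⟨ ∑-mono (downFrom t) (λ {i} _ → ∑-mono options (λ {c} _ →
             𝟙-mono (admissible? i c (((n , w) , α) , w₂)) (near? A b D (n * w₂) (abscissa i c)) (λ (_ , _ , _ , near) → near))) ⟩
      ∑[ i ∈ downFrom t ] ∑[ c ∈ options ] g (b * i + proj₁ c)
        ≡⟨ ∑-cong (downFrom t) (λ i → ∑-options (λ u → g (b * i + u))) ⟩
      ∑[ i ∈ downFrom t ] (b * ∑[ u ∈ downFrom b ] g (b * i + u))
        ≡⟨ ∑-*ˡ (downFrom t) b _ ⟩
      b * ∑[ i ∈ downFrom t ] ∑[ u ∈ downFrom b ] g (b * i + u)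
        ≡⟨ cong (b *_) (∑-blocks b t g) ⟩
      b * ∑ (downFrom (b * t)) g
        ≤⟨ *-monoʳ-≤ b (near-count A b D (n * w₂) (b * t) 1≤D) ⟩
      b * suc (2 * (A * b) ÷ D)
        ≤⟨ *-monoʳ-≤ b (≤-÷ 1≤D (count≤3Z² nw≤A)) ⟩
      b * (3 * (Z * Z) ÷ D)
        ≡⟨ sym (+-identityʳ _) ⟩
      1 * (b * (3 * (Z * Z) ÷ D)) ∎

  -- The `5 w + 1` candidates for `w₂` cancel the `w` in the denominator, so that only `Ratio`
  -- limits the sum over `w`.
  directions≤ : ∀ n w → 1 ≤ n → 1 ≤ w → suc (5 * w) * (3 * (Z * Z) ÷ (n * w)) ≤ 6 * (3 * (Z * Z) ÷ n)
  directions≤ n w 1≤n 1≤w = begin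
    suc (5 * w) * q        ≤⟨ *-monoˡ-≤ q (+-monoˡ-≤ (5 * w) 1≤w) ⟩
    (w + 5 * w) * q        ≡⟨ e w q ⟩
    6 * (w * q)            ≤⟨ *-monoʳ-≤ 6 {w * q} (≤-÷ 1≤n (≤-trans (≤-reflexive (e′ w q n)) (÷-* (3 * (Z * Z)) (n * w)))) ⟩
    6 * (3 * (Z * Z) ÷ n)  ∎
    where
    open ≤-Reasoning
    q = 3 * (Z * Z) ÷ (n * w)
    e : ∀ w q → (w + 5 * w) * q ≡ 6 * (w * q)
    e = solve-∀
    e′ : ∀ w q n → w * q * n ≡ q * (n * w)
    e′ = solve-∀

  -- The factors are `b` vertical offsets, 6 from the slopes, `17 Z` for the pairs `(w , α)`, and
  -- the harmonic sum over `n`.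
  total≤ : total ≤ b * 6 * (17 * Z) * (J * (3 * (Z * Z)))
  total≤ = begin
    ∑[ i ∈ downFrom t ] ∑[ c ∈ options ] ∑[ τ ∈ params ] 𝟙 (admissible? i c τ)
      ≡⟨ ∑-cong (downFrom t) (λ i → ∑-swap options params (λ c τ → 𝟙 (admissible? i c τ))) ⟩
    ∑[ i ∈ downFrom t ] ∑[ τ ∈ params ] ∑[ c ∈ options ] 𝟙 (admissible? i c τ)
      ≡⟨ ∑-swap (downFrom t) params (λ i τ → ∑[ c ∈ options ] 𝟙 (admissible? i c τ)) ⟩
    ∑ params joins
      ≡⟨ trans (∑-⊗ (dyadic J ⊗ (λ _ → interval 1 A) ⊗ (λ (n , _) → downFrom n)) _ joins)
          (trans (∑-⊗ (dyadic J ⊗ (λ _ → interval 1 A)) _ _) (∑-⊗ (dyadic J) _ _)) ⟩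
    ∑[ n ∈ dyadic J ] ∑[ w ∈ interval 1 A ] ∑[ α ∈ downFrom n ] ∑[ w₂ ∈ downFrom (suc (5 * w)) ] joins (((n , w) , α) , w₂)
      ≤⟨ ∑-mono (dyadic J) (λ {n} n∈ → ∑-mono (interval 1 A) (λ {w} w∈ → ∑-mono (downFrom n) (λ {α} α∈ →
           w₂-sum n w α (∈-dyadic⁻ J n∈) (∈-interval⁻ 1 A w∈)))) ⟩
    ∑[ n ∈ dyadic J ] ∑[ w ∈ interval 1 A ] ∑[ α ∈ downFrom n ] (k n * 𝟙 (ratio? Z n w α))
      ≡⟨ ∑-cong (dyadic J) (λ n → trans (∑-cong (interval 1 A) (λ w → ∑-*ˡ (downFrom n) (k n) _)) (∑-*ˡ (interval 1 A) (k n) _)) ⟩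
    ∑[ n ∈ dyadic J ] (k n * ∑[ w ∈ interval 1 A ] count (ratio? Z n w) n)
      ≤⟨ ∑-mono (dyadic J) (λ {n} n∈ → *-monoʳ-≤ (k n) (Ratios.ratios≤17Z Z n 1≤Z (∈-dyadic⁻ J n∈) A)) ⟩
    ∑[ n ∈ dyadic J ] (k n * (17 * Z))
      ≡⟨ ∑-cong (dyadic J) (λ n → e b (17 * Z) (3 * (Z * Z) ÷ n)) ⟩
    ∑[ n ∈ dyadic J ] (b * 6 * (17 * Z) * (3 * (Z * Z) ÷ n))
      ≡⟨ ∑-*ˡ (dyadic J) (b * 6 * (17 * Z)) (λ n → 3 * (Z * Z) ÷ n) ⟩
    b * 6 * (17 * Z) * ∑[ n ∈ dyadic J ] (3 * (Z * Z) ÷ n)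
      ≤⟨ *-monoʳ-≤ (b * 6 * (17 * Z)) (harmonic (3 * (Z * Z)) J) ⟩
    b * 6 * (17 * Z) * (J * (3 * (Z * Z))) ∎
    where
    open ≤-Reasoning
    joins : Params → ℕ
    joins τ = ∑[ i ∈ downFrom t ] ∑[ c ∈ options ] 𝟙 (admissible? i c τ)
    k : ℕ → ℕ
    k n = b * (6 * (3 * (Z * Z) ÷ n))
    e : ∀ b z q → b * (6 * q) * z ≡ b * 6 * z * q
    e = solve-∀
    e′ : ∀ l r b q → l * (r * (b * q)) ≡ b * (l * q) * r
    e′ = solve-∀
    w₂-sum : ∀ n w α → 1 ≤ n → 1 ≤ w →
      ∑[ w₂ ∈ downFrom (suc (5 * w)) ] joins (((n , w) , α) , w₂) ≤ k n * 𝟙 (ratio? Z n w α)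
    w₂-sum n w α 1≤n 1≤w = begin
      ∑[ w₂ ∈ downFrom (suc (5 * w)) ] joins (((n , w) , α) , w₂)
        ≤⟨ ∑≤length* (downFrom (suc (5 * w))) _ (λ {w₂} _ → joins≤ n w α w₂ 1≤n 1≤w) ⟩
      length (downFrom (suc (5 * w))) * (r * (b * q))
        ≡⟨ cong (_* (r * (b * q))) (length-downFrom (suc (5 * w))) ⟩
      suc (5 * w) * (r * (b * q))
        ≡⟨ e′ (suc (5 * w)) r b q ⟩
      b * (suc (5 * w) * q) * r
        ≤⟨ *-monoˡ-≤ r (*-monoʳ-≤ b (directions≤ n w 1≤n 1≤w)) ⟩
      k n * r ∎
      where
      r = 𝟙 (ratio? Z n w α)
      q = 3 * (Z * Z) ÷ (n * w)

  -- A fixed selection and its subset without collinear triples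

  module Selection (s : List (ℕ × ℕ)) (s∈ : ∀ i → get s i ∈ options) where

    u<b : ∀ i → proj₁ (get s i) < b
    u<b i = proj₁ (options-bound (s∈ i))

    v<b : ∀ i → proj₂ (get s i) < b
    v<b i = proj₂ (options-bound (s∈ i))

    P : ℕ → Point
    P i = point i (get s i)

    P-block : ∀ i → proj₁ (P i) / b ≡ i
    P-block i = block i {get s i} (u<b i)

    P-injective : ∀ {i j} → P i ≡ P j → i ≡ j
    P-injective {i} {j} eq = trans (sym (P-block i)) (trans (cong (λ p → proj₁ p / b) eq) (P-block j))

    x-< : ∀ {i j} → i < j → proj₁ (P i) < proj₁ (P j)
    x-< {i} {j} = abscissa-< {c = get s i} {get s j} (u<b i)

    y-≤ : ∀ {i j} → i < j → proj₂ (P i) ≤ proj₂ (P j)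
    y-≤ {i} {j} = ordinate-≤ {c = get s i} {get s j} (u<b i) (v<b i)

    P-strip : ∀ i → Strip A b (proj₁ (P i)) (proj₂ (P i))
    P-strip i = strip i {get s i} (u<b i) (v<b i)

    at-P : ∀ j → at s (P j) ≡ 1
    at-P j = 𝟙-yes (point (proj₁ (P j) / b) (get s (proj₁ (P j) / b)) ≟ₚ P j) (cong P (P-block j))

    -- The triple is a term of `bad i s` with the parameters of `primitive-step`; the work lies in
    -- showing that these are admissible and belong to the finite list `params`.
    detect : ∀ {i j l} → i < j → j < l → l < t → Collinear (P i) (P j) (P l) → 1 ≤ bad i s
    detect {i} {j} {l} i<j j<l l<t coll = found (primitive-step a D e f 1≤a a<D
        (collinear⇒ℕ x y (subst₂ (Collinear (P i)) Pj≡ Pl≡ coll)))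
      where
      open ≤-Reasoning
      c = get s i
      x = proj₁ (P i)
      y = proj₂ (P i)
      a = proj₁ (P j) ∸ x
      D = proj₁ (P l) ∸ x
      e = proj₂ (P j) ∸ y
      f = proj₂ (P l) ∸ y
      xj≡ = m+[n∸m]≡n (<⇒≤ (x-< i<j))
      xl≡ = m+[n∸m]≡n (<⇒≤ (x-< (<-trans i<j j<l)))
      Pj≡ : P j ≡ (x + a , y + e)
      Pj≡ = sym (cong₂ _,_ xj≡ (m+[n∸m]≡n (y-≤ i<j)))
      Pl≡ : P l ≡ (x + D , y + f)
      Pl≡ = sym (cong₂ _,_ xl≡ (m+[n∸m]≡n (y-≤ (<-trans i<j j<l))))
      1≤a : 1 ≤ a
      1≤a = m<n⇒0<n∸m (x-< i<j)
      a<D : a < D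
      a<D = ∸-monoˡ-< (x-< j<l) (<⇒≤ (x-< i<j))
      -- Block `j` lies strictly between blocks `i` and `l`, so a whole block width separates `P i`
      -- from `P l`.
      b≤D : b ≤ D
      b≤D = +-cancelˡ-≤ x b D (begin
        x + b              ≤⟨ +-monoˡ-≤ b (<⇒≤ (proj₁ (abscissa-step {c = c} {c} (u<b i) i<j))) ⟩
        b * suc i + b      ≡⟨ trans (+-comm (b * suc i) b) (sym (*-suc b (suc i))) ⟩
        b * suc (suc i)    ≤⟨ *-monoʳ-≤ b (s≤s i<j) ⟩
        b * suc j          ≤⟨ proj₂ (abscissa-step {c = c} {get s l} (u<b i) j<l) ⟩
        proj₁ (P l)        ≡⟨ sym xl≡ ⟩
        x + D              ∎)
      x+D<A : x + D < A
      x+D<A = subst (_< A) (sym xl≡) (abscissa<A {c = get s l} (u<b l) l<t)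
      found : (∃ λ n → ∃ λ w → ∃ λ α → ∃ λ w₂ →
        1 ≤ α × α < n × 1 ≤ w × a ≡ α * w × D ≡ n * w × e ≡ α * w₂ × f ≡ n * w₂) → 1 ≤ bad i s
      found (n , w , α , w₂ , 1≤α , α<n , 1≤w , a≡ , D≡ , e≡ , f≡) = begin
          1                                                                             ≡⟨ sym (cong₂ _*_ (𝟙-yes (admissible? i c τ) admissible) occurs≡1) ⟩
          𝟙 (admissible? i c τ) * occurs i c τ s                                        ≤⟨ term≤∑ (λ τ → 𝟙 (admissible? i c τ) * occurs i c τ s) τ∈ ⟩
          ∑[ τ ∈ params ] (𝟙 (admissible? i c τ) * occurs i c τ s)                      ≤⟨ term≤∑ (λ c → ∑[ τ ∈ params ] (𝟙 (admissible? i c τ) * occurs i c τ s)) (s∈ i) ⟩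
          bad i s                                                                       ∎
        where
        τ = ((n , w) , α) , w₂
        Q≡ : P j ≡ translate (P i) α w w₂
        Q≡ = trans Pj≡ (cong₂ (λ p q → x + p , y + q) a≡ e≡)
        R≡ : P l ≡ translate (P i) n w w₂
        R≡ = trans Pl≡ (cong₂ (λ p q → x + p , y + q) D≡ f≡)
        j≡ : (x + α * w) / b ≡ j
        j≡ = trans (cong (λ p → proj₁ p / b) (sym Q≡)) (P-block j)
        l≡ : (x + n * w) / b ≡ l
        l≡ = trans (cong (λ p → proj₁ p / b) (sym R≡)) (P-block l)
        stripQ : Strip A b (x + α * w) (y + α * w₂)
        stripQ = subst (λ p → Strip A b (proj₁ p) (proj₂ p)) Q≡ (P-strip j)
        stripR : Strip A b (x + n * w) (y + n * w₂)
        stripR = subst (λ p → Strip A b (proj₁ p) (proj₂ p)) R≡ (P-strip l)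
        nearby : Near A b (n * w) (n * w₂) x
        nearby = near A b x y (n * w) (n * w₂) (P-strip i) stripR
        x+nw<A : x + n * w < A
        x+nw<A = subst (λ d → x + d < A) D≡ x+D<A
        nw<A : n * w < A
        nw<A = ≤-<-trans (m≤n+m (n * w) x) x+nw<A
        1≤n : 1 ≤ n
        1≤n = ≤-trans (s≤s z≤n) α<n
        admissible : Admissible i c τ
        admissible = (subst (i <_) (sym j≡) i<j , subst₂ _<_ (sym j≡) (sym l≡) j<l , subst (_< t) (sym l≡) l<t) ,
          (1≤α , subst (λ z → α * (n ∸ α) * (w * w) ≤ 2 * z) (sym Z²≡Ab) (curvature A b x y n α w w₂ α<n (P-strip i) stripQ stripR)) ,
          <⇒≤ nw<A , nearby
        occurs≡1 : occurs i c τ s ≡ 1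
        occurs≡1 = cong₂ _*_ (𝟙-yes (c ≟ₚ c) refl)
          (cong₂ _*_ (trans (cong (at s) (sym Q≡)) (at-P j)) (trans (cong (at s) (sym R≡)) (at-P l)))
        w₂≤5w : w₂ ≤ 5 * w
        w₂≤5w = *-cancelˡ-≤ n {{>-nonZero 1≤n}} (≤-trans
          (slope≤5 A b (n * w) (n * w₂) x nearby (<⇒≤ x+nw<A) (subst (b ≤_) D≡ b≤D)) (≤-reflexive (swap 5 n w)))
          where
          swap : ∀ a b c → a * (b * c) ≡ b * (a * c)
          swap = solve-∀
        τ∈ : τ ∈ params
        τ∈ = ∈-⊗⁺ (∈-⊗⁺ (∈-⊗⁺
          (∈-dyadic⁺ J 1≤n (<-≤-trans (≤-<-trans (m≤m*n n w {{>-nonZero 1≤w}}) nw<A) A≤2^J))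
          (∈-interval⁺ 1 A 1≤w (m≤n⇒m≤1+n (≤-<-trans (m≤n*m w n {{>-nonZero 1≤n}}) nw<A))))
          (∈-downFrom⁺ α<n)) (∈-downFrom⁺ (s≤s w₂≤5w))

    good : List ℕ
    good = filter (λ i → bad i s ≟ 0) (downFrom t)

    good⁻ : ∀ {i} → i ∈ good → i < t × bad i s ≡ 0
    good⁻ i∈ with i∈t , ok ← ∈-filter⁻ (λ i → bad i s ≟ 0) {xs = downFrom t} i∈ = ∈-downFrom⁻ i∈t , ok

    good-size : t ≤ length good + ∑[ i ∈ downFrom t ] bad i s
    good-size = begin
      t                                                                            ≡⟨ sym (trans (∑-const (downFrom t) 1) (trans (*-identityʳ _) (length-downFrom t))) ⟩
      ∑[ i ∈ downFrom t ] 1                                                        ≤⟨ ∑-mono (downFrom t) (λ {i} _ → either (bad i s)) ⟩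
      ∑[ i ∈ downFrom t ] (𝟙 (bad i s ≟ 0) + bad i s)                             ≡⟨ ∑-+ (downFrom t) (λ i → 𝟙 (bad i s ≟ 0)) (λ i → bad i s) ⟩
      ∑[ i ∈ downFrom t ] 𝟙 (bad i s ≟ 0) + ∑[ i ∈ downFrom t ] bad i s           ≡⟨ cong (_+ ∑[ i ∈ downFrom t ] bad i s) (∑𝟙≡length-filter (λ i → bad i s ≟ 0) (downFrom t)) ⟩
      length good + ∑[ i ∈ downFrom t ] bad i s                                    ∎
      where
      open ≤-Reasoning
      either : ∀ m → 1 ≤ 𝟙 (m ≟ 0) + m
      either zero    = ≤-refl
      either (suc m) = m≤n⇒m≤o+n (𝟙 (suc m ≟ 0)) (s≤s z≤n)

    no-triple : ∀ {i j l} → i ∈ good → l ∈ good → i < j → j < l → ¬ Collinear (P i) (P j) (P l)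
    no-triple i∈ l∈ i<j j<l coll = <⇒≢ (detect i<j j<l (proj₁ (good⁻ l∈)) coll) (sym (proj₂ (good⁻ i∈)))

    distinct-triple : ∀ {i j l} → i ∈ good → j ∈ good → l ∈ good → i ≢ j → j ≢ l → i ≢ l →
      Tri (i < j) (i ≡ j) (j < i) → Tri (j < l) (j ≡ l) (l < j) → Tri (i < l) (i ≡ l) (l < i) →
      ¬ Collinear (P i) (P j) (P l)
    distinct-triple {i} {j} {l} i∈ j∈ l∈ i≢j j≢l i≢l = λ where
        (tri≈ _ i≡j _) _ _ _ → i≢j i≡j
        _ (tri≈ _ j≡l _) _ _ → j≢l j≡l
        _ _ (tri≈ _ i≡l _) _ → i≢l i≡l
        (tri< i<j _ _) (tri< j<l _ _) _              coll → no-triple i∈ l∈ i<j j<l coll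
        (tri< _   _ _) (tri> _ _ l<j) (tri< i<l _ _) coll → no-triple i∈ j∈ i<l l<j (swap₂₃ i j l coll)
        (tri< i<j _ _) (tri> _ _ _)   (tri> _ _ l<i) coll → no-triple l∈ j∈ l<i i<j (swap₁₂ i l j (swap₂₃ i j l coll))
        (tri> _ _ j<i) (tri< _ _ _)   (tri< i<l _ _) coll → no-triple j∈ l∈ j<i i<l (swap₁₂ i j l coll)
        (tri> _ _ _)   (tri< j<l _ _) (tri> _ _ l<i) coll → no-triple j∈ i∈ j<l l<i (swap₂₃ j i l (swap₁₂ i j l coll))
        (tri> _ _ j<i) (tri> _ _ l<j) _              coll → no-triple l∈ i∈ l<j j<i (swap₁₂ j l i (swap₂₃ j i l (swap₁₂ i j l coll)))
      where
      swap₁₂ : ∀ i j l → Collinear (P i) (P j) (P l) → Collinear (P j) (P i) (P l)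
      swap₁₂ i j l = collinear-swap₁₂ (P i) (P j) (P l)
      swap₂₃ : ∀ i j l → Collinear (P i) (P j) (P l) → Collinear (P i) (P l) (P j)
      swap₂₃ i j l = collinear-swap₂₃ (P i) (P j) (P l)

    generalPosition : GeneralPosition (map P good)
    generalPosition u∈ v∈ w∈ = go (∈-map⁻ P u∈) (∈-map⁻ P v∈) (∈-map⁻ P w∈)
      where
      go : ∀ {u v w} → (∃ λ i → i ∈ good × u ≡ P i) → (∃ λ j → j ∈ good × v ≡ P j) → (∃ λ l → l ∈ good × w ≡ P l) →
        u ≢ v → v ≢ w → u ≢ w → ¬ Collinear u v w
      go (i , i∈ , refl) (j , j∈ , refl) (l , l∈ , refl) u≢v v≢w u≢w =
        distinct-triple i∈ j∈ l∈ (u≢v ∘ cong P) (v≢w ∘ cong P) (u≢w ∘ cong P) (<-cmp i j) (<-cmp j l) (<-cmp i l)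

    increasing : ∀ {u v} → u ∈ map P good → v ∈ map P good → proj₁ u < proj₁ v → proj₂ u ≤ proj₂ v
    increasing u∈ v∈ = go (∈-map⁻ P u∈) (∈-map⁻ P v∈)
      where
      ordered : ∀ {i j} → Tri (i < j) (i ≡ j) (j < i) → proj₁ (P i) < proj₁ (P j) → proj₂ (P i) ≤ proj₂ (P j)
      ordered (tri< i<j _ _)  _   = y-≤ i<j
      ordered (tri≈ _ refl _) _   = ≤-refl
      ordered (tri> _ _ j<i)  u<v = contradiction u<v (<⇒≯ (x-< j<i))
      go : ∀ {u v} → (∃ λ i → i ∈ good × u ≡ P i) → (∃ λ j → j ∈ good × v ≡ P j) → proj₁ u < proj₁ v → proj₂ u ≤ proj₂ v
      go (i , _ , refl) (j , _ , refl) = ordered (<-cmp i j)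

    inGrid : ∀ {k} → 3 * A ≤ k → ∀ {i} → i < t → InGrid k (P i)
    inGrid {k} 3A≤k {i} i<t = <-≤-trans x<A (≤-trans (m≤m+n A _) 3A≤k) , <-≤-trans y<3A 3A≤k
      where
      open ≤-Reasoning
      x = proj₁ (P i)
      x<A : x < A
      x<A = abscissa<A {c = get s i} (u<b i) i<t
      b≤A : b ≤ A
      b≤A = subst (b ≤_) (sym A≡bt) (m≤m*n b t {{>-nonZero (≤-trans (s≤s z≤n) i<t)}})
      y<3A : b * i + x * x / A + proj₂ (get s i) < 3 * A
      y<3A = begin-strict
        b * i + x * x / A + proj₂ (get s i)    <⟨ +-mono-< (+-mono-< (≤-<-trans (m≤m+n (b * i) _) x<A)
                                                    (m<n*o⇒m/o<n (*-mono-< x<A x<A))) (<-≤-trans (v<b i) b≤A) ⟩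
        A + A + A                              ≡⟨ e A ⟩
        3 * A                                  ∎
        where
        e : ∀ a → a + a + a ≡ 3 * a
        e = solve-∀

    mgp : ∀ {k} → 3 * A ≤ k → MGPSubset k (map P good)
    mgp 3A≤k = Unique.map⁺ P-injective (Unique.filter⁺ (λ i → bad i s ≟ 0) (Unique.downFrom⁺ t)) ,
      All.map⁺ (All.tabulate (λ i∈ → inGrid 3A≤k (proj₁ (good⁻ i∈)))) , inj₁ increasing , generalPosition

  -- The hypothesis says that the expected total charge is at most `t / 2`, where `(b * b) ^ 3` is
  -- the inverse of the probability of a triple; some selection then keeps half of its points.
  few-bad⇒large : ∀ {k} → 3 * A ≤ k → 2 * (b * 6 * (17 * Z) * (J * (3 * (Z * Z)))) ≤ (b * b) ^ 3 * t →
    Σ (List Point) λ S → MGPSubset k S × t ≤ 2 * length S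
  few-bad⇒large 3A≤k few with derandomise t (λ s → ∑[ i ∈ downFrom t ] bad i s)
  ... | s , s∈ , average-s = map P good , mgp 3A≤k , t≤2S
    where
    open Selection s s∈
    open ≤-Reasoning
    F = ∑[ i ∈ downFrom t ] bad i s
    instance
      β≢0 : NonZero β
      β≢0 = >-nonZero 1≤β
    β³F≤total : β ^ 3 * F ≤ total
    β³F≤total = *-cancelʳ-≤ (β ^ 3 * F) total (β ^ t) {{m^n≢0 β t}} (begin
      β ^ 3 * F * β ^ t                                  ≡⟨ e (β ^ 3) F (β ^ t) ⟩
      β ^ 3 * (β ^ t * F)                                ≤⟨ *-monoʳ-≤ (β ^ 3) average-s ⟩
      β ^ 3 * E t (λ s → ∑[ i ∈ downFrom t ] bad i s)    ≤⟨ E-bad ⟩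
      total * β ^ t                                      ∎)
      where
      e : ∀ a b c → a * b * c ≡ a * (c * b)
      e = solve-∀
    2F≤t : 2 * F ≤ t
    2F≤t = *-cancelˡ-≤ (β ^ 3) {{m^n≢0 β 3}} (begin
      β ^ 3 * (2 * F)                                    ≡⟨ e (β ^ 3) F ⟩
      2 * (β ^ 3 * F)                                    ≤⟨ *-monoʳ-≤ 2 (≤-trans β³F≤total total≤) ⟩
      2 * (b * 6 * (17 * Z) * (J * (3 * (Z * Z))))       ≤⟨ few ⟩
      (b * b) ^ 3 * t                                    ≡⟨ cong (λ z → z ^ 3 * t) (sym β≡b²) ⟩
      β ^ 3 * t                                          ∎)
      where
      e : ∀ a b → a * (2 * b) ≡ 2 * (a * b)
      e = solve-∀
    t≤2S : t ≤ 2 * length (map P good)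
    t≤2S = +-cancelʳ-≤ t _ _ (begin
      t + t                              ≡⟨ e t ⟩
      2 * t                              ≤⟨ *-monoʳ-≤ 2 good-size ⟩
      2 * (length good + F)              ≡⟨ *-distribˡ-+ 2 (length good) F ⟩
      2 * length good + 2 * F            ≤⟨ +-monoʳ-≤ (2 * length good) 2F≤t ⟩
      2 * length good + t                ≡⟨ cong (λ n → 2 * n + t) (sym (length-map P good)) ⟩
      2 * length (map P good) + t        ∎)
      where
      e : ∀ a → a + a ≡ 2 * a
      e = solve-∀

-- The lower bound

-- A discrete inverse of `g`, found by descending from `suc n`, where `m ≤ g m` gives
-- `n < g (suc n)`.
bracket : ∀ (g : ℕ → ℕ) n → (∀ m → m ≤ g m) → g 0 ≤ n → ∃ λ m → g m ≤ n × n < g (suc m)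
bracket g n m≤gm g0≤n = go n (m≤gm (suc n))
  where
  go : ∀ m → n < g (suc m) → ∃ λ m → g m ≤ n × n < g (suc m)
  go zero    n< = 0 , g0≤n , n<
  go (suc m) n< with g (suc m) ≤? n
  ... | yes g≤n = suc m , g≤n , n<
  ... | no  g≰n = go m (≰⇒> g≰n)

1+n≤2^n : ∀ n → suc n ≤ 2 ^ n
1+n≤2^n zero    = ≤-refl
1+n≤2^n (suc n) = ≤-trans (+-mono-≤ (m^n>0 2 n) (1+n≤2^n n)) (≤-reflexive (cong (2 ^ n +_) (sym (+-identityʳ _))))

n<2^[1+log₂n] : ∀ n → n < 2 ^ suc ⌊log₂ n ⌋
n<2^[1+log₂n] n = ≰⇒> (λ 2^≤n → <⇒≱ (n<1+n ⌊log₂ n ⌋)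
  (subst (_≤ ⌊log₂ n ⌋) (⌊log₂[2^n]⌋≡n (suc ⌊log₂ n ⌋)) (⌊log₂⌋-mono-≤ 2^≤n)))

2^log₂n≤2n : ∀ n → 1 ≤ n → 2 ^ ⌊log₂ n ⌋ ≤ 2 * n
2^log₂n≤2n n 1≤n with bracket (2 ^_) n (λ m → <⇒≤ (1+n≤2^n m)) 1≤n
... | j , 2^j≤n , n< = ≤-trans (^-monoʳ-≤ 2 log≤) (*-monoʳ-≤ 2 2^j≤n)
  where
  log≤ : ⌊log₂ n ⌋ ≤ suc j
  log≤ = subst (⌊log₂ n ⌋ ≤_) (⌊log₂[2^n]⌋≡n (suc j)) (⌊log₂⌋-mono-≤ (<⇒≤ n<))

cube : ℕ → ℕ
cube x = x * x * x

fifth : ℕ → ℕ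
fifth x = x * x * x * x * x

-- With `q = l / 7` and `x = 2 ^ q` one has `l ≤ 7 x`, so the left side is at most `C x⁶`, while
-- `x⁷ ≤ 2 ^ l`; it remains to have `C ≤ x`.
sixth-power≤exponential : ∀ c → ∃ λ Λ → ∀ l → Λ ≤ l → c * (cube l * cube l) ≤ 2 ^ l
sixth-power≤exponential c = C * 7 , bound
  where
  open ≤-Reasoning
  C = c * (cube 7 * cube 7)
  bound : ∀ l → C * 7 ≤ l → c * (cube l * cube l) ≤ 2 ^ l
  bound l Λ≤l = begin
    c * (cube l * cube l)                ≤⟨ *-monoʳ-≤ c (*-mono-≤ cube≤ cube≤) ⟩
    c * (cube (7 * x) * cube (7 * x))    ≡⟨ e₁ c 7 x ⟩
    C * (cube x * cube x)                ≤⟨ *-monoˡ-≤ (cube x * cube x) (≤-trans C≤q (≤-trans (n≤1+n q) (1+n≤2^n q))) ⟩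
    x * (cube x * cube x)                ≡⟨ e₂ x ⟩
    x ^ 7                                ≡⟨ ^-*-assoc 2 q 7 ⟩
    2 ^ (q * 7)                          ≤⟨ ^-monoʳ-≤ 2 (m/n*n≤m l 7) ⟩
    2 ^ l                                ∎
    where
    q = l / 7
    x = 2 ^ q
    e₁ : ∀ c d x → c * ((d * x) * (d * x) * (d * x) * ((d * x) * (d * x) * (d * x))) ≡ c * (d * d * d * (d * d * d)) * (x * x * x * (x * x * x))
    e₁ = solve-∀
    e₂ : ∀ x → x * (x * x * x * (x * x * x)) ≡ x * (x * (x * (x * (x * (x * (x * 1))))))
    e₂ = solve-∀
    l≤7x : l ≤ 7 * x
    l≤7x = begin
      l                  ≡⟨ m≡m%n+[m/n]*n l 7 ⟩
      l % 7 + q * 7      ≤⟨ +-monoˡ-≤ (q * 7) (m%n≤n l 7) ⟩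
      suc q * 7          ≡⟨ *-comm (suc q) 7 ⟩
      7 * suc q          ≤⟨ *-monoʳ-≤ 7 (1+n≤2^n q) ⟩
      7 * x              ∎
    cube≤ : cube l ≤ cube (7 * x)
    cube≤ = *-mono-≤ (*-mono-≤ l≤7x l≤7x) l≤7x
    C≤q : C ≤ q
    C≤q = subst (_≤ q) (m*n/n≡m C 7) (/-monoˡ-≤ 7 Λ≤l)

-- Squaring turns this into a comparison of `l⁶` with `k²`, and `2 ^ l ≤ 2 k²`. It guarantees that
-- `m = 1` fits into the grid, so that a largest fitting `m` can be sought.
eventually-λ³-small : ∀ a → ∃ λ K → ∀ k → K ≤ k → 1 ≤ ⌊log₂ (k * k) ⌋ × a * cube ⌊log₂ (k * k) ⌋ ≤ k
eventually-λ³-small a = 2 ^ suc Λ , λ k K≤k → bound k K≤k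
  where
  open ≤-Reasoning
  Λ = proj₁ (sixth-power≤exponential (2 * (a * a)))
  bound : ∀ k → 2 ^ suc Λ ≤ k → 1 ≤ ⌊log₂ (k * k) ⌋ × a * cube ⌊log₂ (k * k) ⌋ ≤ k
  bound k K≤k = ≤-trans (s≤s z≤n) 1+Λ≤l , ≮⇒≥ (λ k< → <⇒≱ (*-mono-< k< k<) square≤)
    where
    l = ⌊log₂ (k * k) ⌋
    1≤k : 1 ≤ k
    1≤k = ≤-trans (m^n>0 2 (suc Λ)) K≤k
    1+Λ≤l : suc Λ ≤ l
    1+Λ≤l = subst (_≤ l) (⌊log₂[2^n]⌋≡n (suc Λ)) (⌊log₂⌋-mono-≤ (≤-trans K≤k (m≤m*n k k {{>-nonZero 1≤k}})))
    e : ∀ a y → 2 * (a * y * (a * y)) ≡ 2 * (a * a) * (y * y)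
    e = solve-∀
    square≤ : a * cube l * (a * cube l) ≤ k * k
    square≤ = *-cancelˡ-≤ 2 (begin
      2 * (a * cube l * (a * cube l))       ≡⟨ e a (cube l) ⟩
      2 * (a * a) * (cube l * cube l)       ≤⟨ proj₂ (sixth-power≤exponential (2 * (a * a))) l (≤-trans (n≤1+n Λ) 1+Λ≤l) ⟩
      2 ^ l                                 ≤⟨ 2^log₂n≤2n (k * k) (*-mono-≤ 1≤k 1≤k) ⟩
      2 * (k * k)                           ∎)

construction : ∀ k m l → 1 ≤ m → 1 ≤ l → k < 2 ^ suc l → 105 * (fifth m * cube l) ≤ k →
  Σ (List Point) λ S → MGPSubset k S × m * m * m * m * (l * l) ≤ 2 * length S
construction k m l 1≤m 1≤l k<2^ size≤k =
    let S , mgp , t≤2S = few-bad⇒large 3A≤k few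
    in S , mgp , subst (_≤ 2 * length S) (e₁ m l) t≤2S
  where
  -- This gives `b² = 1225 r l`, and `1225 = 35²` is the first square above the
  -- `1224 = 2 · 2 · 6 · 17 · 3` that `few` requires, one factor 2 coming from `l + 1 ≤ 2 l`. Also
  -- `3 A = 105 m⁵ l³`.
  b = 35 * (m * l)
  r = m * m * l
  t = r * r
  A = b * t
  Z = b * r
  instance
    m≢0 : NonZero m
    m≢0 = >-nonZero 1≤m
    l≢0 : NonZero l
    l≢0 = >-nonZero 1≤l
    b≢0 : NonZero b
    b≢0 = m*n≢0 35 (m * l) {{_}} {{m*n≢0 m l}}
    r≢0 : NonZero r
    r≢0 = m*n≢0 (m * m) l {{m*n≢0 m m}}
    A≢0 : NonZero A
    A≢0 = m*n≢0 b t {{b≢0}} {{m*n≢0 r r}}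
  e₁ : ∀ m l → m * m * l * (m * m * l) ≡ m * m * m * m * (l * l)
  e₁ = solve-∀
  e₂ : ∀ b r → b * r * (b * r) ≡ b * (r * r) * b
  e₂ = solve-∀
  e₃ : ∀ m l → 3 * (35 * (m * l) * (m * m * l * (m * m * l))) ≡ 105 * (m * m * m * m * m * (l * l * l))
  e₃ = solve-∀
  3A≤k : 3 * A ≤ k
  3A≤k = ≤-trans (≤-reflexive (e₃ m l)) size≤k
  A≤2^J : A ≤ 2 ^ suc l
  A≤2^J = ≤-trans (m≤m+n A _) (≤-trans 3A≤k (<⇒≤ k<2^))
  few : 2 * (b * 6 * (17 * Z) * (suc l * (3 * (Z * Z)))) ≤ (b * b) ^ 3 * t
  few = few′ b r l 1≤l (e₄ m l)
    where
    e₄ : ∀ m l → 35 * (m * l) * (35 * (m * l)) ≡ 1225 * (m * m * l * l)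
    e₄ = solve-∀
    few′ : ∀ b r l → 1 ≤ l → b * b ≡ 1225 * (r * l) →
      2 * (b * 6 * (17 * (b * r)) * (suc l * (3 * (b * r * (b * r))))) ≤ (b * b) ^ 3 * (r * r)
    few′ b r l 1≤l b²≡ = begin
      2 * (b * 6 * (17 * (b * r)) * (suc l * (3 * (b * r * (b * r)))))    ≡⟨ e₅ b r (suc l) ⟩
      612 * (b * b * (b * b) * (r * r * r) * suc l)                      ≤⟨ *-monoʳ-≤ 612 (*-monoʳ-≤ (b * b * (b * b) * (r * r * r)) (+-monoˡ-≤ l 1≤l)) ⟩
      612 * (b * b * (b * b) * (r * r * r) * (l + l))                    ≡⟨ e₆ (b * b * (b * b)) r l ⟩
      1224 * (b * b * (b * b) * (r * r) * (r * l))                       ≤⟨ *-monoˡ-≤ (b * b * (b * b) * (r * r) * (r * l)) (n≤1+n 1224) ⟩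
      1225 * (b * b * (b * b) * (r * r) * (r * l))                       ≡⟨ e₇ 1225 (b * b * (b * b)) (r * r) (r * l) ⟩
      b * b * (b * b) * (r * r) * (1225 * (r * l))                       ≡⟨ cong (b * b * (b * b) * (r * r) *_) (sym b²≡) ⟩
      b * b * (b * b) * (r * r) * (b * b)                                ≡⟨ e₈ (b * b) (r * r) ⟩
      b * b * (b * b * (b * b * 1)) * (r * r)                            ∎
      where
      open ≤-Reasoning
      e₅ : ∀ b r j → 2 * (b * 6 * (17 * (b * r)) * (j * (3 * (b * r * (b * r))))) ≡ 612 * (b * b * (b * b) * (r * r * r) * j)
      e₅ = solve-∀
      e₆ : ∀ p r l → 612 * (p * (r * r * r) * (l + l)) ≡ 1224 * (p * (r * r) * (r * l))
      e₆ = solve-∀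
      e₇ : ∀ c p q s → c * (p * q * s) ≡ p * q * (c * s)
      e₇ = solve-∀
      e₈ : ∀ p q → p * p * q * p ≡ p * (p * (p * 1)) * q
      e₈ = solve-∀
  open Construction b t A Z (suc l) (>-nonZero⁻¹ Z {{m*n≢0 b r}}) refl (e₂ b r) A≤2^J

fifth-power-bound : ∀ c k m l f → k ≤ c * (fifth m * cube l) → m * m * m * m * (l * l) ≤ 2 * f →
  (k * k) ^ 2 ≤ (c * c * (c * c) * 32) * f ^ 5 * l ^ 2
fifth-power-bound c k m l f k≤ p≤ = begin
  k * k * (k * k * 1)                                        ≡⟨ cong (k * k *_) (*-identityʳ (k * k)) ⟩
  k * k * (k * k)                                            ≤⟨ *-mono-≤ (*-mono-≤ k≤ k≤) (*-mono-≤ k≤ k≤) ⟩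
  y * y * (y * y)                                            ≡⟨ e₁ c m l ⟩
  c * c * (c * c) * fifth p * (l * l)                        ≤⟨ *-monoˡ-≤ (l * l) (*-monoʳ-≤ (c * c * (c * c)) (*-mono-≤ (*-mono-≤ (*-mono-≤ (*-mono-≤ p≤ p≤) p≤) p≤) p≤)) ⟩
  c * c * (c * c) * fifth (2 * f) * (l * l)                  ≡⟨ e₂ (c * c * (c * c)) f l ⟩
  (c * c * (c * c) * 32) * f ^ 5 * l ^ 2                     ∎
  where
  open ≤-Reasoning
  p = m * m * m * m * (l * l)
  y = c * (fifth m * cube l)
  e₁ : ∀ c m l → c * (m * m * m * m * m * (l * l * l)) * (c * (m * m * m * m * m * (l * l * l))) * (c * (m * m * m * m * m * (l * l * l)) * (c * (m * m * m * m * m * (l * l * l)))) ≡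
    c * c * (c * c) * (m * m * m * m * (l * l) * (m * m * m * m * (l * l)) * (m * m * m * m * (l * l)) * (m * m * m * m * (l * l)) * (m * m * m * m * (l * l))) * (l * l)
  e₁ = solve-∀
  e₂ : ∀ d f l → d * (2 * f * (2 * f) * (2 * f) * (2 * f) * (2 * f)) * (l * l) ≡ (d * 32) * (f * (f * (f * (f * (f * 1))))) * (l * (l * 1))
  e₂ = solve-∀

-- To be used with a = 105 and c = 105 * 32, kept as variables because the type checker unfolds the
-- product of a large literal and a variable into a sum.
optimise-parameters : ∀ a c .{{_ : NonZero a}} → c ≡ a * 32 →
  (∀ k m l → 1 ≤ m → 1 ≤ l → k < 2 ^ suc l → a * (fifth m * cube l) ≤ k →
    Σ (List Point) λ S → MGPSubset k S × m * m * m * m * (l * l) ≤ 2 * length S) →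
  ∀ k l → l ≡ ⌊log₂ (k * k) ⌋ → 1 ≤ l → a * cube l ≤ k →
    Σ (List Point) λ S → MGPSubset k S × (k * k) ^ 2 ≤ (c * c * (c * c) * 32) * length S ^ 5 * l ^ 2
optimise-parameters a c c≡ construct k l l≡ 1≤l λ³≤k =
    let m₀ , fits , tight = bracket (λ m → a * (fifth (suc m) * cube l)) k grows
                              (subst (λ z → a * z ≤ k) (sym (+-identityʳ (cube l))) λ³≤k)
        S , mgp , large = construct k (suc m₀) l (s≤s z≤n) 1≤l k<2^ fits
    in S , mgp , fifth-power-bound c k (suc m₀) l (length S) (k≤ m₀ tight) large
  where
  open ≤-Reasoning
  1≤l³ : 1 ≤ cube l
  1≤l³ = *-mono-≤ (*-mono-≤ 1≤l 1≤l) 1≤l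
  1≤k : 1 ≤ k
  1≤k = ≤-trans 1≤l³ (≤-trans (m≤n*m (cube l) a) λ³≤k)
  k<2^ : k < 2 ^ suc l
  k<2^ = subst (λ l → k < 2 ^ suc l) (sym l≡) (≤-<-trans (m≤m*n k k {{>-nonZero 1≤k}}) (n<2^[1+log₂n] (k * k)))
  grows : ∀ m → m ≤ a * (fifth (suc m) * cube l)
  grows m = begin
    m                               ≤⟨ n≤1+n m ⟩
    suc m                           ≤⟨ m≤n*m (suc m) (suc m * suc m * suc m * suc m) ⟩
    fifth (suc m)                   ≤⟨ m≤m*n (fifth (suc m)) (cube l) {{>-nonZero 1≤l³}} ⟩
    fifth (suc m) * cube l          ≤⟨ m≤n*m (fifth (suc m) * cube l) a ⟩
    a * (fifth (suc m) * cube l)    ∎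
  -- Passing from `m + 1` to `2 m` costs the factor `2⁵ = 32` contained in `c`.
  k≤ : ∀ m₀ → k < a * (fifth (suc (suc m₀)) * cube l) → k ≤ c * (fifth (suc m₀) * cube l)
  k≤ m₀ tight = begin
    k                                   ≤⟨ <⇒≤ tight ⟩
    a * (fifth (suc m) * cube l)        ≤⟨ *-monoʳ-≤ a (*-monoˡ-≤ (cube l) (*-mono-≤ (*-mono-≤ (*-mono-≤ (*-mono-≤ 1+m≤2m 1+m≤2m) 1+m≤2m) 1+m≤2m) 1+m≤2m)) ⟩
    a * (fifth (2 * m) * cube l)        ≡⟨ e a m (cube l) ⟩
    a * 32 * (fifth m * cube l)         ≡⟨ cong (_* (fifth m * cube l)) (sym c≡) ⟩
    c * (fifth m * cube l)              ∎
    where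
    m = suc m₀
    1+m≤2m : suc m ≤ 2 * m
    1+m≤2m = ≤-trans (+-monoˡ-≤ m (s≤s z≤n)) (≤-reflexive (cong (m +_) (sym (+-identityʳ m))))
    e : ∀ a m y → a * (2 * m * (2 * m) * (2 * m) * (2 * m) * (2 * m) * y) ≡ a * 32 * (m * m * m * m * m * y)
    e = solve-∀

lower-bound : ∃ λ C → ∃ λ K → ∀ k → k ≥ K →
  Σ (List Point) λ S → MGPSubset k S × ((k * k) ^ 2 ≤ C * (length S ^ 5) * (⌊log₂ (k * k) ⌋ ^ 2))
lower-bound = c * c * (c * c) * 32 , proj₁ (eventually-λ³-small 105) , λ k k≥K →
    let 1≤l , λ³≤k = proj₂ (eventually-λ³-small 105) k k≥K
    in optimise-parameters 105 c refl construction k ⌊log₂ (k * k) ⌋ refl 1≤l λ³≤k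
  where
  c = 105 * 32

-- Windows of a chain

-- Dirichlet's theorem `|X / L − p / q| ≤ 1 / (q Q)` with denominators cleared: the `Q + 1` residues
-- of `i X` modulo `L` fall into `Q` bins of width `L / Q`, and `q` is the difference of two indices
-- in one bin.
dirichlet : ∀ Q L X .{{_ : NonZero Q}} .{{_ : NonZero L}} →
  ∃₂ λ q p → 1 ≤ q × q ≤ Q × Q * (q * X) ≤ Q * (p * L) + L × Q * (p * L) ≤ Q * (q * X) + L
dirichlet Q L X with pigeonhole (n<1+n Q) (λ i → fromℕ< (bin<Q (toℕ i)))
  where
  bin<Q : ∀ i → (Q * (i * X % L)) / L < Q
  bin<Q i = m<n*o⇒m/o<n (*-monoʳ-< Q (m%n<n (i * X) L))
... | i' , j' , i<j , same = q , p , m<n⇒0<n∸m i<j , ≤-trans (m∸n≤m j i) (s≤s⁻¹ (toℕ<n j')) , upper , lower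
  where
  i = toℕ i' ; j = toℕ j'
  bin : ℕ → ℕ
  bin k = (Q * (k * X % L)) / L
  bin≡ : bin i ≡ bin j
  bin≡ = trans (sym (toℕ-fromℕ< _)) (trans (cong toℕ same) (toℕ-fromℕ< _))
  ri = i * X % L ; rj = j * X % L
  pi = i * X / L ; pj = j * X / L
  q = j ∸ i
  p = pj ∸ pi
  key : q * X + ri ≡ rj + p * L
  key = +-cancelʳ-≡ (pi * L) (q * X + ri) (rj + p * L) (begin
    q * X + ri + pi * L      ≡⟨ +-assoc (q * X) ri (pi * L) ⟩
    q * X + (ri + pi * L)    ≡⟨ cong (q * X +_) (sym (m≡m%n+[m/n]*n (i * X) L)) ⟩
    q * X + i * X            ≡⟨ sym (*-distribʳ-+ X q i) ⟩
    (q + i) * X              ≡⟨ cong (_* X) (m∸n+n≡m (<⇒≤ i<j)) ⟩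
    j * X                    ≡⟨ m≡m%n+[m/n]*n (j * X) L ⟩
    rj + pj * L              ≡⟨ cong (λ z → rj + z * L) (sym (m∸n+n≡m (/-monoˡ-≤ L (*-monoˡ-≤ X (<⇒≤ i<j))))) ⟩
    rj + (p + pi) * L        ≡⟨ cong (rj +_) (*-distribʳ-+ L p pi) ⟩
    rj + (p * L + pi * L)    ≡⟨ sym (+-assoc rj _ _) ⟩
    rj + p * L + pi * L      ∎)
    where open ≡-Reasoning
  close : ∀ r r' → (Q * r) / L ≡ (Q * r') / L → Q * r ≤ Q * r' + L
  close r r' eq = begin
    Q * r                                        ≡⟨ m≡m%n+[m/n]*n (Q * r) L ⟩
    (Q * r) % L + (Q * r) / L * L                ≤⟨ +-mono-≤ (m%n≤n (Q * r) L) (≤-reflexive (cong (_* L) eq)) ⟩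
    L + (Q * r') / L * L                         ≤⟨ +-monoʳ-≤ L (m/n*n≤m (Q * r') L) ⟩
    L + Q * r'                                   ≡⟨ +-comm L _ ⟩
    Q * r' + L                                   ∎
    where open ≤-Reasoning
  open ≤-Reasoning
  upper : Q * (q * X) ≤ Q * (p * L) + L
  upper = +-cancelʳ-≤ (Q * ri) _ _ (begin
    Q * (q * X) + Q * ri          ≡⟨ sym (*-distribˡ-+ Q _ _) ⟩
    Q * (q * X + ri)              ≡⟨ cong (Q *_) key ⟩
    Q * (rj + p * L)              ≡⟨ *-distribˡ-+ Q _ _ ⟩
    Q * rj + Q * (p * L)          ≤⟨ +-monoˡ-≤ _ (close rj ri (sym bin≡)) ⟩
    Q * ri + L + Q * (p * L)      ≡⟨ rearrange (Q * ri) L (Q * (p * L)) ⟩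
    Q * (p * L) + L + Q * ri      ∎)
    where
    rearrange : ∀ a b c → a + b + c ≡ c + b + a
    rearrange = solve-∀
  lower : Q * (p * L) ≤ Q * (q * X) + L
  lower = +-cancelʳ-≤ (Q * rj) _ _ (begin
    Q * (p * L) + Q * rj          ≡⟨ sym (*-distribˡ-+ Q _ _) ⟩
    Q * (p * L + rj)              ≡⟨ cong (Q *_) (trans (+-comm _ rj) (sym key)) ⟩
    Q * (q * X + ri)              ≡⟨ *-distribˡ-+ Q _ _ ⟩
    Q * (q * X) + Q * ri          ≤⟨ +-monoʳ-≤ _ (close ri rj bin≡) ⟩
    Q * (q * X) + (Q * rj + L)    ≡⟨ rearrange (Q * (q * X)) (Q * rj) L ⟩
    Q * (q * X) + L + Q * rj      ∎)
    where
    rearrange : ∀ a b c → a + (b + c) ≡ a + c + b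
    rearrange = solve-∀

-- The potential of a window is (h M L + X²) / L².  It is convex in (X / L, M / L), and
-- strictly so in X / L; denominators are cleared throughout.
split-identity : ∀ h L₁ L₂ X₁ X₂ M₁ M₂ Δ → X₁ * L₂ ≡ X₂ * L₁ + Δ ⊎ X₂ * L₁ ≡ X₁ * L₂ + Δ →
  (h * M₁ * L₁ + X₁ * X₁) * (L₂ * (L₁ + L₂)) + (h * M₂ * L₂ + X₂ * X₂) * (L₁ * (L₁ + L₂))
  ≡ L₁ * L₂ * (h * (M₁ + M₂) * (L₁ + L₂) + (X₁ + X₂) * (X₁ + X₂)) + Δ * Δ
split-identity h L₁ L₂ X₁ X₂ M₁ M₂ Δ dev = +-cancelʳ-≡ (2 * (P * R)) _ _
    (trans (expand h L₁ L₂ X₁ X₂ M₁ M₂) (trans (cong (main +_) (squares dev)) (regroup main (P * R) (Δ * Δ))))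
  where
  P = X₁ * L₂
  R = X₂ * L₁
  main = L₁ * L₂ * (h * (M₁ + M₂) * (L₁ + L₂) + (X₁ + X₂) * (X₁ + X₂))
  expand : ∀ h L₁ L₂ X₁ X₂ M₁ M₂ →
    (h * M₁ * L₁ + X₁ * X₁) * (L₂ * (L₁ + L₂)) + (h * M₂ * L₂ + X₂ * X₂) * (L₁ * (L₁ + L₂)) + 2 * (X₁ * L₂ * (X₂ * L₁))
    ≡ L₁ * L₂ * (h * (M₁ + M₂) * (L₁ + L₂) + (X₁ + X₂) * (X₁ + X₂)) + (X₁ * L₂ * (X₁ * L₂) + X₂ * L₁ * (X₂ * L₁))
  expand = solve-∀
  regroup : ∀ a b c → a + (2 * b + c) ≡ a + c + 2 * b
  regroup = solve-∀
  square₁ : ∀ r d → (r + d) * (r + d) + r * r ≡ 2 * ((r + d) * r) + d * d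
  square₁ = solve-∀
  square₂ : ∀ r d → r * r + (r + d) * (r + d) ≡ 2 * (r * (r + d)) + d * d
  square₂ = solve-∀
  squares : P ≡ R + Δ ⊎ R ≡ P + Δ → P * P + R * R ≡ 2 * (P * R) + Δ * Δ
  squares (inj₁ eq) rewrite eq = square₁ R Δ
  squares (inj₂ eq) rewrite eq = square₂ P Δ

-- By `split-identity`, the mean potential of the pieces with weights `L₁ / L` and `L₂ / L` exceeds
-- that of the whole by `Δ² / (L₁ L₂ L²)`. The second hypothesis makes this at least `1 / E`, one
-- unit of `c`.
potential-increment : ∀ E c h L₁ L₂ X₁ X₂ M₁ M₂ Δ .{{_ : NonZero L₁}} .{{_ : NonZero L₂}} →
  X₁ * L₂ ≡ X₂ * L₁ + Δ ⊎ X₂ * L₁ ≡ X₁ * L₂ + Δ →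
  L₁ * L₂ * ((L₁ + L₂) * (L₁ + L₂)) ≤ E * (Δ * Δ) →
  c * ((L₁ + L₂) * (L₁ + L₂)) ≤ E * (h * (M₁ + M₂) * (L₁ + L₂) + (X₁ + X₂) * (X₁ + X₂)) →
  suc c * (L₁ * L₁) ≤ E * (h * M₁ * L₁ + X₁ * X₁) ⊎ suc c * (L₂ * L₂) ≤ E * (h * M₂ * L₂ + X₂ * X₂)
potential-increment E c h L₁@(suc _) L₂@(suc _) X₁ X₂ M₁ M₂ Δ dev large pot
  with suc c * (L₁ * L₁) ≤? E * (h * M₁ * L₁ + X₁ * X₁) | suc c * (L₂ * L₂) ≤? E * (h * M₂ * L₂ + X₂ * X₂)
... | yes p₁ | _      = inj₁ p₁
... | no _   | yes p₂ = inj₂ p₂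
... | no n₁  | no n₂  = contradiction chain (<-irrefl refl)
  where
  open ≤-Reasoning
  L = L₁ + L₂
  φ₁ = h * M₁ * L₁ + X₁ * X₁
  φ₂ = h * M₂ * L₂ + X₂ * X₂
  φ = h * (M₁ + M₂) * L + (X₁ + X₂) * (X₁ + X₂)
  collect : ∀ c L₁ L₂ → suc c * (L₁ * L₁) * (L₂ * (L₁ + L₂)) + suc c * (L₂ * L₂) * (L₁ * (L₁ + L₂))
          ≡ L₁ * L₂ * (c * ((L₁ + L₂) * (L₁ + L₂))) + L₁ * L₂ * ((L₁ + L₂) * (L₁ + L₂))
  collect = solve-∀
  pull : ∀ e a b c → a * (e * b) + e * c ≡ e * (a * b + c)
  pull = solve-∀
  push : ∀ e a b c d → e * (a * b + c * d) ≡ e * a * b + e * c * d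
  push = solve-∀
  chain : suc c * (L₁ * L₁) * (L₂ * L) + suc c * (L₂ * L₂) * (L₁ * L) < suc c * (L₁ * L₁) * (L₂ * L) + suc c * (L₂ * L₂) * (L₁ * L)
  chain = begin-strict
    suc c * (L₁ * L₁) * (L₂ * L) + suc c * (L₂ * L₂) * (L₁ * L)
      ≡⟨ collect c L₁ L₂ ⟩
    L₁ * L₂ * (c * (L * L)) + L₁ * L₂ * (L * L)
      ≤⟨ +-mono-≤ (*-monoʳ-≤ (L₁ * L₂) pot) large ⟩
    L₁ * L₂ * (E * φ) + E * (Δ * Δ)
      ≡⟨ pull E (L₁ * L₂) φ (Δ * Δ) ⟩
    E * (L₁ * L₂ * φ + Δ * Δ)
      ≡⟨ cong (E *_) (sym (split-identity h L₁ L₂ X₁ X₂ M₁ M₂ Δ dev)) ⟩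
    E * (φ₁ * (L₂ * L) + φ₂ * (L₁ * L))
      ≡⟨ push E φ₁ (L₂ * L) φ₂ (L₁ * L) ⟩
    E * φ₁ * (L₂ * L) + E * φ₂ * (L₁ * L)
      <⟨ +-mono-<-≤ (*-monoˡ-< (L₂ * L) (≰⇒> n₁)) (*-monoˡ-≤ (L₁ * L) (<⇒≤ (≰⇒> n₂))) ⟩
    suc c * (L₁ * L₁) * (L₂ * L) + suc c * (L₂ * L₂) * (L₁ * L) ∎

-- Here s is an increasing parameter along the chain and x one coordinate, so that
-- the lines of the plane (apart from those with s constant) are q x = p s + const.
module Chain {A : Set} (S : List A) (x s : A → ℕ) (unique : Unique S)
  (chain : ∀ {u v} → u ∈ S → v ∈ S → s u ≤ s v → x u ≤ x v × x v + s u ≤ x u + s v)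
  (s-injective : ∀ {u v} → u ∈ S → v ∈ S → s u ≡ s v → ¬ u ≢ v)
  (no-line : ∀ {u v w} → u ∈ S → v ∈ S → w ∈ S → u ≢ v → v ≢ w → u ≢ w → ∀ p q → 1 ≤ q →
    q * x u + p * s v ≡ q * x v + p * s u → q * x u + p * s w ≡ q * x w + p * s u → ⊥)
  where

  -- Half-open, so that the counts of the two pieces of a cut add up exactly.
  Win? : ∀ u v z → Dec (s u ≤ s z × s z < s v)
  Win? u v z = (s u ≤? s z) ×-dec (s z <? s v)

  M : A → A → ℕ
  M u v = ∑ S (λ z → 𝟙 (Win? u v z))

  M-split : ∀ u z v → s u ≤ s z → s z ≤ s v → M u v ≡ M u z + M z v
  M-split u z v u≤z z≤v = trans (∑-cong S pointwise) (∑-+ S _ _)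
    where
    pointwise : ∀ a → 𝟙 (Win? u v a) ≡ 𝟙 (Win? u z a) + 𝟙 (Win? z v a)
    pointwise a with s a <? s z
    ... | yes a<z rewrite 𝟙-no (s z ≤? s a ×-dec s a <? s v) (λ (z≤a , _) → <⇒≱ a<z z≤a) with s u ≤? s a
    ...   | yes u≤a rewrite 𝟙-yes (yes u≤a ×-dec s a <? s v) (u≤a , <-≤-trans a<z z≤v) = refl
    ...   | no u≰a  = refl
    pointwise a | no a≮z with s a <? s v
    ...   | yes a<v rewrite 𝟙-yes (s u ≤? s a ×-dec yes a<v) (≤-trans u≤z (≮⇒≥ a≮z) , a<v)
                          | 𝟙-no (s u ≤? s a ×-dec no a≮z) (λ (_ , a<z) → a≮z a<z)
                          | 𝟙-yes (s z ≤? s a ×-dec yes a<v) (≮⇒≥ a≮z , a<v) = refl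
    ...   | no a≮v  rewrite 𝟙-no (s u ≤? s a ×-dec no a≮v) (λ (_ , a<v) → a≮v a<v)
                          | 𝟙-no (s u ≤? s a ×-dec no a≮z) (λ (_ , a<z) → a≮z a<z)
                          | 𝟙-no (s z ≤? s a ×-dec no a≮v) (λ (_ , a<v) → a≮v a<v) = refl

  M≤L : ∀ u v L → s v ≡ s u + L → M u v ≤ L
  M≤L u v L sv = subst (M u v ≤_) (*-identityʳ L)
      (fibres (Win? u v) (λ z → s z ∸ s u) L 1 bounded
        (λ a → atMostOne (λ z → Win? u v z ×-dec s z ∸ s u ≟ a) unique
          (λ x∈ y∈ ((u≤x , _) , ex) ((u≤y , _) , ey) →
            s-injective x∈ y∈ (∸-cancelʳ-≡ u≤x u≤y (trans ex (sym ey))))))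
    where
    bounded : ∀ {z} → z ∈ S → s u ≤ s z × s z < s v → s z ∸ s u < L
    bounded {z} _ (u≤z , z<v) = +-cancelˡ-< (s u) (s z ∸ s u) L
      (subst₂ _<_ (sym (m+[n∸m]≡n u≤z)) sv z<v)

  X≤L : ∀ {u v L X} → u ∈ S → v ∈ S → s v ≡ s u + L → x v ≡ x u + X → X ≤ L
  X≤L {u} {v} {L} {X} u∈ v∈ sv xv = +-cancelˡ-≤ (x u + s u) X L (begin
    x u + s u + X      ≡⟨ swap (x u) (s u) X ⟩
    x u + X + s u      ≡⟨ cong (_+ s u) (sym xv) ⟩
    x v + s u          ≤⟨ proj₂ (chain u∈ v∈ (subst (s u ≤_) (sym sv) (m≤m+n (s u) L))) ⟩
    x u + s v          ≡⟨ cong (x u +_) sv ⟩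
    x u + (s u + L)    ≡⟨ sym (+-assoc (x u) (s u) L) ⟩
    x u + s u + L      ∎)
    where
    open ≤-Reasoning
    swap : ∀ a b c → a + b + c ≡ a + c + b
    swap = solve-∀

  scaled-≤ : ∀ Q a b c .{{_ : NonZero Q}} → Q * a ≤ Q * b + c → a ≤ b + c / Q
  scaled-≤ Q a b c Qa≤ = ≤-trans (m≤n+m∸n a b) (+-monoʳ-≤ b (begin
    a ∸ b                  ≡⟨ sym (m*n/n≡m (a ∸ b) Q) ⟩
    (a ∸ b) * Q / Q        ≤⟨ /-monoˡ-≤ Q (begin
      (a ∸ b) * Q            ≡⟨ *-comm (a ∸ b) Q ⟩
      Q * (a ∸ b)            ≡⟨ *-distribˡ-∸ Q a b ⟩
      Q * a ∸ Q * b          ≤⟨ m≤n+o⇒m∸n≤o (Q * a) (Q * b) Qa≤ ⟩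
      c                      ∎) ⟩
    c / Q                  ∎))
    where open ≤-Reasoning

  -- If the window deviates from its chord by at most L / Q², then all its points lie on at most
  -- 4 L / Q + 1 lines of a direction of denominator q ≤ Q approximating the chord.
  straight-window : ∀ Q .{{_ : NonZero Q}} u v L .{{_ : NonZero L}} X → u ∈ S → s v ≡ s u + L →
    (∀ {z} → z ∈ S → s u ≤ s z × s z < s v → Q * Q * ∣ (x z ∸ x u) * L - X * (s z ∸ s u) ∣ ≤ L * L) →
    Q * M u v ≤ 8 * L + 2 * Q
  straight-window Q u v L X u∈ sv straight with dirichlet Q L X
  ... | q , p , 1≤q , q≤Q , qX≤pL , pL≤qX = begin
      Q * M u v                ≤⟨ *-monoʳ-≤ Q (fibres (Win? u v) h (suc (R + R)) 2 h< fibre≤2) ⟩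
      Q * (suc (R + R) * 2)    ≡⟨ expand Q R ⟩
      4 * (R * Q) + 2 * Q      ≤⟨ +-monoˡ-≤ (2 * Q) (*-monoʳ-≤ 4 (m/n*n≤m (2 * L) Q)) ⟩
      4 * (2 * L) + 2 * Q      ≡⟨ cong (_+ 2 * Q) (sym (*-assoc 4 2 L)) ⟩
      8 * L + 2 * Q            ∎
    where
    open ≤-Reasoning
    -- The integer `q X′ − p L′` is off by at most `q L / Q² ≤ L / Q` from straightness and by
    -- `L / Q` from Dirichlet, so it lies in `[−R, R]`.
    R = 2 * L / Q
    X′ L′ h : A → ℕ
    X′ z = x z ∸ x u
    L′ z = s z ∸ s u
    -- The line through `z`, shifted by `R` to a natural number; `below` makes the truncated
    -- subtraction exact.
    h z = (q * X′ z + R) ∸ p * L′ z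
    expand : ∀ a b → a * (suc (b + b) * 2) ≡ 4 * (b * a) + 2 * a
    expand = solve-∀

    L′≤L : ∀ {z} → s z < s v → L′ z ≤ L
    L′≤L {z} z<v = m≤n+o⇒m∸n≤o (s z) (s u) (subst (s z ≤_) sv (<⇒≤ z<v))

    dev₁ : ∀ {z} → z ∈ S → s u ≤ s z × s z < s v → Q * Q * (X′ z * L) ≤ Q * Q * (X * L′ z) + L * L
    dev₁ {z} z∈ w = ≤-trans (*-monoʳ-≤ (Q * Q) (m≤n+∣m-n∣ (X′ z * L) (X * L′ z)))
      (≤-trans (≤-reflexive (*-distribˡ-+ (Q * Q) (X * L′ z) _)) (+-monoʳ-≤ _ (straight z∈ w)))
    dev₂ : ∀ {z} → z ∈ S → s u ≤ s z × s z < s v → Q * Q * (X * L′ z) ≤ Q * Q * (X′ z * L) + L * L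
    dev₂ {z} z∈ w = ≤-trans (*-monoʳ-≤ (Q * Q) (m≤n+∣n-m∣ (X * L′ z) (X′ z * L)))
      (≤-trans (≤-reflexive (*-distribˡ-+ (Q * Q) (X′ z * L) _)) (+-monoʳ-≤ _ (straight z∈ w)))

    instance
      QL≢0 : NonZero (Q * L)
      QL≢0 = m*n≢0 Q L

    above : ∀ {z} → z ∈ S → s u ≤ s z × s z < s v → q * X′ z ≤ p * L′ z + R
    above {z} z∈ w = scaled-≤ Q _ _ (2 * L) (*-cancelˡ-≤ (Q * L) (begin
      Q * L * (Q * (q * X′ z))                                ≡⟨ e₁ Q L q (X′ z) ⟩
      q * (Q * Q * (X′ z * L))                                ≤⟨ *-monoʳ-≤ q (dev₁ z∈ w) ⟩
      q * (Q * Q * (X * L′ z) + L * L)                        ≡⟨ e₂ Q L q X (L′ z) ⟩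
      Q * L′ z * (Q * (q * X)) + q * (L * L)                  ≤⟨ +-mono-≤ (*-monoʳ-≤ (Q * L′ z) qX≤pL) (*-monoˡ-≤ (L * L) q≤Q) ⟩
      Q * L′ z * (Q * (p * L) + L) + Q * (L * L)              ≡⟨ e₃ Q L p (L′ z) ⟩
      Q * L * (Q * (p * L′ z)) + Q * (L′ z * L) + Q * (L * L) ≤⟨ +-monoˡ-≤ (Q * (L * L)) (+-monoʳ-≤ _ (*-monoʳ-≤ Q (*-monoˡ-≤ L (L′≤L (proj₂ w))))) ⟩
      Q * L * (Q * (p * L′ z)) + Q * (L * L) + Q * (L * L)    ≡⟨ e₄ Q L p (L′ z) ⟩
      Q * L * (Q * (p * L′ z) + 2 * L)                        ∎))
      where
      e₁ : ∀ Q L q y → Q * L * (Q * (q * y)) ≡ q * (Q * Q * (y * L))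
      e₁ = solve-∀
      e₂ : ∀ Q L q X l → q * (Q * Q * (X * l) + L * L) ≡ Q * l * (Q * (q * X)) + q * (L * L)
      e₂ = solve-∀
      e₃ : ∀ Q L p l → Q * l * (Q * (p * L) + L) + Q * (L * L) ≡ Q * L * (Q * (p * l)) + Q * (l * L) + Q * (L * L)
      e₃ = solve-∀
      e₄ : ∀ Q L p l → Q * L * (Q * (p * l)) + Q * (L * L) + Q * (L * L) ≡ Q * L * (Q * (p * l) + 2 * L)
      e₄ = solve-∀

    below : ∀ {z} → z ∈ S → s u ≤ s z × s z < s v → p * L′ z ≤ q * X′ z + R
    below {z} z∈ w = scaled-≤ Q _ _ (2 * L) (*-cancelˡ-≤ (Q * L) (begin
      Q * L * (Q * (p * L′ z))                                ≡⟨ e₁ Q L p (L′ z) ⟩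
      Q * L′ z * (Q * (p * L))                                ≤⟨ *-monoʳ-≤ (Q * L′ z) pL≤qX ⟩
      Q * L′ z * (Q * (q * X) + L)                            ≡⟨ e₂ Q L q X (L′ z) ⟩
      q * (Q * Q * (X * L′ z)) + Q * (L′ z * L)               ≤⟨ +-mono-≤ (*-monoʳ-≤ q (dev₂ z∈ w)) (*-monoʳ-≤ Q (*-monoˡ-≤ L (L′≤L (proj₂ w)))) ⟩
      q * (Q * Q * (X′ z * L) + L * L) + Q * (L * L)          ≡⟨ e₃ Q L q (X′ z) ⟩
      Q * L * (Q * (q * X′ z)) + q * (L * L) + Q * (L * L)    ≤⟨ +-monoˡ-≤ (Q * (L * L)) (+-monoʳ-≤ _ (*-monoˡ-≤ (L * L) q≤Q)) ⟩
      Q * L * (Q * (q * X′ z)) + Q * (L * L) + Q * (L * L)    ≡⟨ e₄ Q L q (X′ z) ⟩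
      Q * L * (Q * (q * X′ z) + 2 * L)                        ∎))
      where
      e₁ : ∀ Q L p l → Q * L * (Q * (p * l)) ≡ Q * l * (Q * (p * L))
      e₁ = solve-∀
      e₂ : ∀ Q L q X l → Q * l * (Q * (q * X) + L) ≡ q * (Q * Q * (X * l)) + Q * (l * L)
      e₂ = solve-∀
      e₃ : ∀ Q L q y → q * (Q * Q * (y * L) + L * L) + Q * (L * L) ≡ Q * L * (Q * (q * y)) + q * (L * L) + Q * (L * L)
      e₃ = solve-∀
      e₄ : ∀ Q L p l → Q * L * (Q * (p * l)) + Q * (L * L) + Q * (L * L) ≡ Q * L * (Q * (p * l) + 2 * L)
      e₄ = solve-∀

    h< : ∀ {z} → z ∈ S → s u ≤ s z × s z < s v → h z < suc (R + R)
    h< {z} z∈ w = s≤s (m≤n+o⇒m∸n≤o (q * X′ z + R) (p * L′ z)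
      (≤-trans (+-monoˡ-≤ R (above z∈ w)) (≤-reflexive (+-assoc (p * L′ z) R R))))

    on-line : ∀ {z z′} → z ∈ S → z′ ∈ S → s u ≤ s z × s z < s v → s u ≤ s z′ × s z′ < s v → h z ≡ h z′ →
      q * x z + p * s z′ ≡ q * x z′ + p * s z
    on-line {z} {z′} z∈ z′∈ w w′ eq = begin-equality
        q * x z + p * s z′                          ≡⟨ cong₂ (λ a b → q * a + p * b) (sym (m∸n+n≡m (proj₁ (chain u∈ z∈ (proj₁ w))))) (sym (m∸n+n≡m (proj₁ w′))) ⟩
        q * (X′ z + x u) + p * (L′ z′ + s u)        ≡⟨ e q p (X′ z) (x u) (L′ z′) (s u) ⟩
        q * X′ z + p * L′ z′ + (q * x u + p * s u)  ≡⟨ cong (_+ (q * x u + p * s u)) core ⟩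
        q * X′ z′ + p * L′ z + (q * x u + p * s u)  ≡⟨ sym (e q p (X′ z′) (x u) (L′ z) (s u)) ⟩
        q * (X′ z′ + x u) + p * (L′ z + s u)        ≡⟨ cong₂ (λ a b → q * a + p * b) (m∸n+n≡m (proj₁ (chain u∈ z′∈ (proj₁ w′)))) (m∸n+n≡m (proj₁ w)) ⟩
        q * x z′ + p * s z                          ∎
      where
      e : ∀ q p a b c d → q * (a + b) + p * (c + d) ≡ q * a + p * c + (q * b + p * d)
      e = solve-∀
      core : q * X′ z + p * L′ z′ ≡ q * X′ z′ + p * L′ z
      core = +-cancelʳ-≡ (R + h z) _ _ (begin-equality
        q * X′ z + p * L′ z′ + (R + h z)     ≡⟨ cong (λ a → q * X′ z + p * L′ z′ + (R + a)) eq ⟩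
        q * X′ z + p * L′ z′ + (R + h z′)    ≡⟨ e₁ (q * X′ z) (p * L′ z′) R (h z′) ⟩
        q * X′ z + R + (h z′ + p * L′ z′)    ≡⟨ cong₂ _+_ (sym (m∸n+n≡m (below z∈ w))) (m∸n+n≡m (below z′∈ w′)) ⟩
        h z + p * L′ z + (q * X′ z′ + R)     ≡⟨ e₂ (h z) (p * L′ z) (q * X′ z′) R ⟩
        q * X′ z′ + p * L′ z + (R + h z)     ∎)
        where
        e₁ : ∀ a b c d → a + b + (c + d) ≡ a + c + (d + b)
        e₁ = solve-∀
        e₂ : ∀ a b c d → a + b + (c + d) ≡ c + b + (d + a)
        e₂ = solve-∀

    fibre≤2 : ∀ a → ∑ S (λ z → 𝟙 (Win? u v z ×-dec h z ≟ a)) ≤ 2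
    fibre≤2 a = atMostTwo (λ z → Win? u v z ×-dec h z ≟ a) unique
      λ x∈ y∈ z∈ (wx , hx) (wy , hy) (wz , hz) x≢y y≢z x≢z →
        no-line x∈ y∈ z∈ x≢y y≢z x≢z p q 1≤q
          (on-line x∈ y∈ wx wy (trans hx (sym hy))) (on-line x∈ z∈ wx wz (trans hx (sym hz)))

  window-split : ∀ {u v z} → u ∈ S → v ∈ S → z ∈ S → s u ≤ s z → s z ≤ s v → ∀ {L X} →
    s v ≡ s u + L → x v ≡ x u + X →
    L ≡ (s z ∸ s u) + (s v ∸ s z) × X ≡ (x z ∸ x u) + (x v ∸ x z)
  window-split {u} {v} {z} u∈ v∈ z∈ u≤z z≤v sv xv =
    go sv u≤z z≤v , go xv (proj₁ (chain u∈ z∈ u≤z)) (proj₁ (chain z∈ v∈ z≤v))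
    where
    go : ∀ {a b c d} → c ≡ a + d → a ≤ b → b ≤ c → d ≡ (b ∸ a) + (c ∸ b)
    go {a} {b} {c} {d} eq a≤b b≤c = +-cancelˡ-≡ a _ _ (begin
      a + d                    ≡⟨ sym eq ⟩
      c                        ≡⟨ sym (m+[n∸m]≡n b≤c) ⟩
      b + (c ∸ b)              ≡⟨ cong (_+ (c ∸ b)) (sym (m+[n∸m]≡n a≤b)) ⟩
      a + (b ∸ a) + (c ∸ b)    ≡⟨ +-assoc a _ _ ⟩
      a + ((b ∸ a) + (c ∸ b))  ∎)
      where open ≡-Reasoning

  -- Descent through windows of increasing potential

  module Descent (m Q : ℕ) .{{_ : NonZero m}} .{{_ : NonZero Q}} (Q≡128m : Q ≡ 128 * m) where

    B E : ℕ
    B = Q * Q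
    E = B * B

    instance
      B≢0 : NonZero B
      B≢0 = m*n≢0 Q Q
      E≢0 : NonZero E
      E≢0 = m*n≢0 B B

    -- `c` measures the potential in units of `1 / E`, the guaranteed gain of one cut.
    Potential≥ : ℕ → A → A → ℕ → ℕ → Set
    Potential≥ c u v L X = c * (L * L) ≤ E * (8 * m * M u v * L + X * X)

    potential-bound : ∀ c u v L X .{{_ : NonZero L}} → M u v ≤ L → X ≤ L →
      Potential≥ c u v L X → c ≤ suc (8 * m) * E
    potential-bound c u v L X M≤ X≤ pot = *-cancelʳ-≤ c _ (L * L) {{m*n≢0 L L}} (begin
      c * (L * L)                            ≤⟨ pot ⟩
      E * (8 * m * M u v * L + X * X)        ≤⟨ *-monoʳ-≤ E (+-mono-≤ (*-monoˡ-≤ L (*-monoʳ-≤ (8 * m) M≤)) (*-mono-≤ X≤ X≤)) ⟩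
      E * (8 * m * L * L + L * L)            ≡⟨ e E (8 * m) L ⟩
      suc (8 * m) * E * (L * L)              ∎)
      where
      open ≤-Reasoning
      e : ∀ E h L → E * (h * L * L + L * L) ≡ suc h * E * (L * L)
      e = solve-∀

    -- Of a potential of at least 2, the slope term `(X / L)²` accounts for at most 1; the rest is
    -- `8 m M / L`.
    density : ∀ c u v L X .{{_ : NonZero L}} → X ≤ L → 2 * E ≤ c → Potential≥ c u v L X → L ≤ 8 * m * M u v
    density c u v L X X≤ 2E≤c pot = *-cancelʳ-≤ L _ L (+-cancelʳ-≤ (L * L) _ _ (*-cancelˡ-≤ E (begin
      E * (L * L + L * L)                    ≡⟨ e E (L * L) ⟩
      2 * E * (L * L)                        ≤⟨ *-monoˡ-≤ (L * L) 2E≤c ⟩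
      c * (L * L)                            ≤⟨ pot ⟩
      E * (8 * m * M u v * L + X * X)        ≤⟨ *-monoʳ-≤ E (+-monoʳ-≤ (8 * m * M u v * L) (*-mono-≤ X≤ X≤)) ⟩
      E * (8 * m * M u v * L + L * L)        ∎)))
      where
      open ≤-Reasoning
      e : ∀ E l → E * (l + l) ≡ 2 * E * l
      e = solve-∀

    -- The origin of `Q = 128 m = 16 · 8 m`: it gives `16 L ≤ Q M ≤ 8 L + 2 Q`, leaving `8 L ≤ 2 Q`.
    dense-straight⇒short : ∀ M L → L ≤ 8 * m * M → Q * M ≤ 8 * L + 2 * Q → L ≤ 32 * m
    dense-straight⇒short M L L≤ QM≤ = *-cancelˡ-≤ 8 (+-cancelˡ-≤ (8 * L) _ _ (begin
      8 * L + 8 * L              ≡⟨ e₁ L ⟩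
      16 * L                     ≤⟨ *-monoʳ-≤ 16 L≤ ⟩
      16 * (8 * m * M)           ≡⟨ e₂ m M ⟩
      128 * m * M                ≡⟨ cong (_* M) (sym Q≡128m) ⟩
      Q * M                      ≤⟨ QM≤ ⟩
      8 * L + 2 * Q              ≡⟨ cong (λ a → 8 * L + 2 * a) Q≡128m ⟩
      8 * L + 2 * (128 * m)      ≡⟨ cong (8 * L +_) (e₃ m) ⟩
      8 * L + 8 * (32 * m)       ∎))
      where
      open ≤-Reasoning
      e₁ : ∀ L → 8 * L + 8 * L ≡ 16 * L
      e₁ = solve-∀
      e₂ : ∀ m M → 16 * (8 * m * M) ≡ 128 * m * M
      e₂ = solve-∀
      e₃ : ∀ m → 2 * (128 * m) ≡ 8 * (32 * m)
      e₃ = solve-∀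

    module Deviation {L₁ L₂ X₁ X₂ : ℕ} (X₁≤L₁ : X₁ ≤ L₁) (X₂≤L₂ : X₂ ≤ L₂)
      (dev : (L₁ + L₂) * (L₁ + L₂) < B * ∣ X₁ * (L₁ + L₂) - (X₁ + X₂) * L₁ ∣) where
      open ≤-Reasoning

      L Δ : ℕ
      L = L₁ + L₂
      Δ = ∣ X₁ * L₂ - X₂ * L₁ ∣

      Δ≡ : ∣ X₁ * L - (X₁ + X₂) * L₁ ∣ ≡ Δ
      Δ≡ = trans (cong₂ ∣_-_∣ (*-distribˡ-+ X₁ L₁ L₂) (*-distribʳ-+ L₁ X₁ X₂))
                 (∣m+n-m+o∣≡∣n-o∣ (X₁ * L₁) (X₁ * L₂) (X₂ * L₁))

      L²<BΔ : L * L < B * Δ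
      L²<BΔ = subst (λ d → L * L < B * d) Δ≡ dev

      Δ-cases : X₁ * L₂ ≡ X₂ * L₁ + Δ ⊎ X₂ * L₁ ≡ X₁ * L₂ + Δ
      Δ-cases with ≤-total (X₁ * L₂) (X₂ * L₁)
      ... | inj₁ le = inj₂ (sym (trans (cong (X₁ * L₂ +_) (m≤n⇒∣m-n∣≡n∸m le)) (m+[n∸m]≡n le)))
      ... | inj₂ ge = inj₁ (sym (trans (cong (X₂ * L₁ +_) (m≤n⇒∣n-m∣≡n∸m ge)) (m+[n∸m]≡n ge)))

      Δ≤L₁L₂ : Δ ≤ L₁ * L₂
      Δ≤L₁L₂ = ≤-trans (∣m-n∣≤m⊔n (X₁ * L₂) (X₂ * L₁))
        (⊔-lub (*-monoˡ-≤ L₂ X₁≤L₁) (≤-trans (*-monoˡ-≤ L₁ X₂≤L₂) (≤-reflexive (*-comm L₂ L₁))))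

      -- Slopes lie in `[0, 1]`, hence `Δ ≤ L₁ L₂`: a point close to an end of the window cannot be
      -- far from the chord, so each piece keeps more than a fraction `1 / B` of the length.
      L<BL₁ : L < B * L₁
      L<BL₁ = *-cancelʳ-< L₂ L (B * L₁) (begin-strict
        L * L₂           ≤⟨ *-monoʳ-≤ L (m≤n+m L₂ L₁) ⟩
        L * L            <⟨ L²<BΔ ⟩
        B * Δ            ≤⟨ *-monoʳ-≤ B Δ≤L₁L₂ ⟩
        B * (L₁ * L₂)    ≡⟨ sym (*-assoc B L₁ L₂) ⟩
        B * L₁ * L₂      ∎)

      L<BL₂ : L < B * L₂
      L<BL₂ = *-cancelʳ-< L₁ L (B * L₂) (begin-strict
        L * L₁           ≤⟨ *-monoʳ-≤ L (m≤m+n L₁ L₂) ⟩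
        L * L            <⟨ L²<BΔ ⟩
        B * Δ            ≤⟨ *-monoʳ-≤ B Δ≤L₁L₂ ⟩
        B * (L₁ * L₂)    ≡⟨ cong (B *_) (*-comm L₁ L₂) ⟩
        B * (L₂ * L₁)    ≡⟨ sym (*-assoc B L₂ L₁) ⟩
        B * L₂ * L₁      ∎)

      -- Squaring `L² < B Δ` is what asks for `E = B²`.
      large : L₁ * L₂ * (L * L) ≤ E * (Δ * Δ)
      large = begin
        L₁ * L₂ * (L * L)        ≤⟨ *-monoˡ-≤ (L * L) (*-mono-≤ (m≤m+n L₁ L₂) (m≤n+m L₂ L₁)) ⟩
        L * L * (L * L)          ≤⟨ *-mono-≤ (<⇒≤ L²<BΔ) (<⇒≤ L²<BΔ) ⟩
        B * Δ * (B * Δ)          ≡⟨ e B Δ ⟩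
        B * B * (Δ * Δ)          ∎
        where
        e : ∀ b d → b * d * (b * d) ≡ b * b * (d * d)
        e = solve-∀

    shrink : ∀ K fuel L L₁ → K * B ^ suc fuel ≤ L → L < B * L₁ → K * B ^ fuel ≤ L₁
    shrink K fuel L L₁ long L< = *-cancelˡ-≤ B (begin
      B * (K * B ^ fuel)    ≡⟨ e B K (B ^ fuel) ⟩
      K * (B * B ^ fuel)    ≤⟨ long ⟩
      L                     ≤⟨ <⇒≤ L< ⟩
      B * L₁                ∎)
      where
      open ≤-Reasoning
      e : ∀ b k c → b * (k * c) ≡ k * (b * c)
      e = solve-∀

    positive : ∀ K fuel L → suc K * B ^ fuel ≤ L → suc K ≤ L
    positive K fuel L long = ≤-trans (m≤m*n (suc K) (B ^ fuel) {{m^n≢0 B fuel}}) long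

    -- A cut moves one unit from `fuel` to `c` and shortens the window by a factor of at most `B`.
    -- Since `c + fuel` exceeds the largest possible potential `(8 m + 1) E`, running out of `fuel`
    -- is contradictory; until then the length stays above `32 m`, which excludes a straight window.
    descent : ∀ fuel c u v L X → u ∈ S → v ∈ S → s v ≡ s u + L → x v ≡ x u + X →
      suc (8 * m) * E < c + fuel → 2 * E ≤ c → suc (32 * m) * B ^ fuel ≤ L → ¬ Potential≥ c u v L X
    descent zero c u v L X u∈ v∈ sv xv exhausted 2E≤c long pot =
      <⇒≱ (subst (suc (8 * m) * E <_) (+-identityʳ c) exhausted)
        (potential-bound c u v L X (M≤L u v L sv) (X≤L u∈ v∈ sv xv) pot)
      where
      instance
        L≢0 : NonZero L
        L≢0 = >-nonZero (≤-trans (s≤s z≤n) (positive (32 * m) 0 L long))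
    descent (suc fuel) c u v L X u∈ v∈ sv xv exhausted 2E≤c long pot
      with any? (λ z → Win? u v z ×-dec (L * L <? B * ∣ (x z ∸ x u) * L - X * (s z ∸ s u) ∣)) S
    ... | no straight = <⇒≱ (positive (32 * m) (suc fuel) L long)
        (dense-straight⇒short (M u v) L (density c u v L X (X≤L u∈ v∈ sv xv) 2E≤c pot)
          (straight-window Q u v L X u∈ sv (λ z∈ w → ≮⇒≥ (λ dev → straight (lose z∈ (w , dev))))))
      where
      instance
        L≢0 : NonZero L
        L≢0 = >-nonZero (≤-trans (s≤s z≤n) (positive (32 * m) (suc fuel) L long))
    ... | yes bent with find bent
    ...   | z , z∈ , (u≤z , z<v) , dev = halves
              (potential-increment E c (8 * m) L₁ L₂ X₁ X₂ (M u z) (M z v) Δ Δ-cases large pot′)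
      where
      L₁ = s z ∸ s u ; L₂ = s v ∸ s z
      X₁ = x z ∸ x u ; X₂ = x v ∸ x z
      z≤v = <⇒≤ z<v
      L≡ = proj₁ (window-split u∈ v∈ z∈ u≤z z≤v sv xv)
      X≡ = proj₂ (window-split u∈ v∈ z∈ u≤z z≤v sv xv)
      sz : s z ≡ s u + L₁
      sz = sym (m+[n∸m]≡n u≤z)
      xz : x z ≡ x u + X₁
      xz = sym (m+[n∸m]≡n (proj₁ (chain u∈ z∈ u≤z)))
      sv′ : s v ≡ s z + L₂
      sv′ = sym (m+[n∸m]≡n z≤v)
      xv′ : x v ≡ x z + X₂
      xv′ = sym (m+[n∸m]≡n (proj₁ (chain z∈ v∈ z≤v)))
      open Deviation (X≤L u∈ z∈ sz xz) (X≤L z∈ v∈ sv′ xv′)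
        (subst₂ (λ l y → l * l < B * ∣ X₁ * l - y * L₁ ∣) L≡ X≡ dev) hiding (L)
      long₁ : suc (32 * m) * B ^ fuel ≤ L₁
      long₁ = shrink (suc (32 * m)) fuel L L₁ long (subst (_< B * L₁) (sym L≡) L<BL₁)
      long₂ : suc (32 * m) * B ^ fuel ≤ L₂
      long₂ = shrink (suc (32 * m)) fuel L L₂ long (subst (_< B * L₂) (sym L≡) L<BL₂)
      instance
        L₁≢0 : NonZero L₁
        L₁≢0 = >-nonZero (≤-trans (s≤s z≤n) (positive (32 * m) fuel L₁ long₁))
        L₂≢0 : NonZero L₂
        L₂≢0 = >-nonZero (≤-trans (s≤s z≤n) (positive (32 * m) fuel L₂ long₂))
      pot′ : c * ((L₁ + L₂) * (L₁ + L₂)) ≤ E * (8 * m * (M u z + M z v) * (L₁ + L₂) + (X₁ + X₂) * (X₁ + X₂))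
      pot′ = subst₂ (λ l y → c * (l * l) ≤ E * (8 * m * (M u z + M z v) * l + y * y)) L≡ X≡
        (subst (λ n → c * (L * L) ≤ E * (8 * m * n * L + X * X)) (M-split u z v u≤z z≤v) pot)
      exhausted′ : suc (8 * m) * E < suc c + fuel
      exhausted′ = subst (suc (8 * m) * E <_) (+-suc c fuel) exhausted
      halves : Potential≥ (suc c) u z L₁ X₁ ⊎ Potential≥ (suc c) z v L₂ X₂ → ⊥
      halves (inj₁ pot₁) = descent fuel (suc c) u z L₁ X₁ u∈ z∈ sz xz exhausted′ (m≤n⇒m≤1+n 2E≤c) long₁ pot₁
      halves (inj₂ pot₂) = descent fuel (suc c) z v L₂ X₂ z∈ v∈ sv′ xv′ exhausted′ (m≤n⇒m≤1+n 2E≤c) long₂ pot₂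

    long-window : ℕ
    long-window = suc (32 * m) * B ^ suc (suc (8 * m) * E)

    nonempty : ∀ (zs : List A) → zs ≢ [] → ∃ λ z → z ∈ zs
    nonempty []       ≢[] = contradiction refl ≢[]
    nonempty (z ∷ _) _    = z , here refl

    least : ∀ {z₀} → z₀ ∈ S → ∃ λ u → u ∈ S × (∀ {z} → z ∈ S → s u ≤ s z)
    least {z₀} z₀∈ = argmin s z₀ S , member (argmin-sel s z₀ S) , All.lookup (f[argmin]≤f[xs] {f = s} z₀ S)
      where
      member : ∀ {u} → u ≡ z₀ ⊎ u ∈ S → u ∈ S
      member (inj₁ refl) = z₀∈
      member (inj₂ u∈)   = u∈

    greatest : ∀ {z₀} → z₀ ∈ S → ∃ λ v → v ∈ S × (∀ {z} → z ∈ S → s z ≤ s v)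
    greatest {z₀} z₀∈ = argmax s z₀ S , member (argmax-sel s z₀ S) , All.lookup (f[xs]≤f[argmax] {f = s} z₀ S)
      where
      member : ∀ {v} → v ≡ z₀ ⊎ v ∈ S → v ∈ S
      member (inj₁ refl) = z₀∈
      member (inj₂ v∈)   = v∈

    -- More than `k / m` points on a parameter range below `2 k` give `8 m M / L ≥ 2`, the starting
    -- level `2 * E` of the descent.
    chain-bound : ∀ k → m * long-window ≤ k → (∀ {z} → z ∈ S → s z < 2 * k) → m * length S ≤ k
    chain-bound k k-large s<2k = ≮⇒≥ refute
      where
      open ≤-Reasoning
      refute : ¬ k < m * length S
      refute k< with nonempty S (λ S≡[] → n≮0 (subst (k <_) (trans (cong (λ zs → m * length zs) S≡[]) (*-zeroʳ m)) k<))
      ... | z₀ , z₀∈ with least z₀∈ | greatest z₀∈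
      ...   | u , u∈ , u-least | v , v∈ , v-greatest =
          descent (suc (suc (8 * m) * E)) (2 * E) u v L (x v ∸ x u) u∈ v∈
            (sym (m+[n∸m]≡n u≤v)) (sym (m+[n∸m]≡n (proj₁ (chain u∈ v∈ u≤v))))
            (m≤n+m _ (2 * E)) ≤-refl (≤-trans long (M≤L u v L (sym (m+[n∸m]≡n u≤v)))) dense
        where
        L = s v ∸ s u
        u≤v = u-least v∈
        in-window : ∀ {z} → z ∈ S → 1 ≤ 𝟙 (Win? u v z) + 𝟙 (s z ≟ s v)
        in-window {z} z∈ with s z ≟ s v
        ... | yes _   = m≤n+m 1 _
        ... | no z≢v = ≤-trans (≤-reflexive (sym (𝟙-yes (Win? u v z) (u-least z∈ , ≤∧≢⇒< (v-greatest z∈) z≢v)))) (m≤m+n _ 0)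
        -- The half-open window from the least to the greatest point misses only the latter.
        N≤1+M : length S ≤ suc (M u v)
        N≤1+M = begin
          length S                                              ≡⟨ sym (trans (∑-const S 1) (*-identityʳ _)) ⟩
          ∑[ z ∈ S ] 1                                          ≤⟨ ∑-mono S in-window ⟩
          ∑[ z ∈ S ] (𝟙 (Win? u v z) + 𝟙 (s z ≟ s v))          ≡⟨ ∑-+ S (λ z → 𝟙 (Win? u v z)) _ ⟩
          M u v + ∑[ z ∈ S ] 𝟙 (s z ≟ s v)                      ≤⟨ +-monoʳ-≤ (M u v) (atMostOne (λ z → s z ≟ s v) unique
                                                                     (λ y∈ z∈ ey ez → s-injective y∈ z∈ (trans ey (sym ez)))) ⟩
          M u v + 1                                             ≡⟨ +-comm (M u v) 1 ⟩
          suc (M u v)                                           ∎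
        k<m[1+M] : k < m * suc (M u v)
        k<m[1+M] = <-≤-trans k< (*-monoʳ-≤ m N≤1+M)
        long : long-window ≤ M u v
        long = s≤s⁻¹ (*-cancelˡ-< m _ _ (≤-<-trans k-large k<m[1+M]))
        k≤2mM : k ≤ 2 * (m * M u v)
        k≤2mM = begin
          k                        ≤⟨ <⇒≤ k<m[1+M] ⟩
          m * suc (M u v)          ≡⟨ *-suc m (M u v) ⟩
          m + m * M u v            ≤⟨ +-monoˡ-≤ (m * M u v) (m≤m*n m (M u v) {{>-nonZero (≤-trans (s≤s z≤n) (≤-trans (positive (32 * m) (suc (suc (8 * m) * E)) long-window ≤-refl) long))}}) ⟩
          m * M u v + m * M u v    ≡⟨ cong (m * M u v +_) (sym (+-identityʳ _)) ⟩
          2 * (m * M u v)          ∎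
        2L≤8mM : 2 * L ≤ 8 * m * M u v
        2L≤8mM = begin
          2 * L                          ≤⟨ *-monoʳ-≤ 2 (≤-trans (m∸n≤m (s v) (s u)) (<⇒≤ (s<2k v∈))) ⟩
          2 * (2 * k)                    ≤⟨ *-monoʳ-≤ 2 (*-monoʳ-≤ 2 k≤2mM) ⟩
          2 * (2 * (2 * (m * M u v)))    ≡⟨ e m (M u v) ⟩
          8 * m * M u v                  ∎
          where
          e : ∀ a b → 2 * (2 * (2 * (a * b))) ≡ 8 * a * b
          e = solve-∀
        dense : Potential≥ (2 * E) u v L (x v ∸ x u)
        dense = begin
          2 * E * (L * L)                                        ≡⟨ e E L ⟩
          E * (2 * L * L)                                        ≤⟨ *-monoʳ-≤ E (*-monoˡ-≤ L 2L≤8mM) ⟩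
          E * (8 * m * M u v * L)                                ≤⟨ *-monoʳ-≤ E (m≤m+n _ _) ⟩
          E * (8 * m * M u v * L + (x v ∸ x u) * (x v ∸ x u))    ∎
          where
          e : ∀ a b → 2 * a * (b * b) ≡ a * (2 * b * b)
          e = solve-∀

-- Monotone point sets as chains

open import Data.Integer using (+_)

line⇒cross : ∀ q p (x s : Point → ℕ) u v w .{{_ : NonZero q}} →
  q * x u + p * s v ≡ q * x v + p * s u → q * x u + p * s w ≡ q * x w + p * s u →
  (+ x v ℤ.- + x u) ℤ.* (+ s w ℤ.- + s u) ≡ (+ s v ℤ.- + s u) ℤ.* (+ x w ℤ.- + x u)
line⇒cross q p x s u v w on-v on-w = ℤ.*-cancelˡ-≡ (+ q) _ _ (begin
    + q ℤ.* (a v ℤ.* d w)        ≡⟨ sym (ℤ.*-assoc (+ q) (a v) (d w)) ⟩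
    + q ℤ.* a v ℤ.* d w          ≡⟨ cong (ℤ._* d w) (slope v on-v) ⟩
    + p ℤ.* d v ℤ.* d w          ≡⟨ e₁ (+ p) (d v) (d w) ⟩
    d v ℤ.* (+ p ℤ.* d w)        ≡⟨ cong (d v ℤ.*_) (sym (slope w on-w)) ⟩
    d v ℤ.* (+ q ℤ.* a w)        ≡⟨ e₂ (+ q) (d v) (a w) ⟩
    + q ℤ.* (d v ℤ.* a w)        ∎)
  where
  open ≡-Reasoning
  a d : Point → ℤ
  a z = + x z ℤ.- + x u
  d z = + s z ℤ.- + s u
  e₁ : ∀ p y z → p ℤ.* y ℤ.* z ≡ y ℤ.* (p ℤ.* z)
  e₁ = ℤ-solve-∀
  e₂ : ∀ q y z → y ℤ.* (q ℤ.* z) ≡ q ℤ.* (y ℤ.* z)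
  e₂ = ℤ-solve-∀
  cast : ∀ a b c d → + (a * b + c * d) ≡ + a ℤ.* + b ℤ.+ + c ℤ.* + d
  cast a b c d = trans (ℤ.pos-+ (a * b) (c * d)) (cong₂ ℤ._+_ (ℤ.pos-* a b) (ℤ.pos-* c d))
  slope : ∀ z → q * x u + p * s z ≡ q * x z + p * s u → + q ℤ.* a z ≡ + p ℤ.* d z
  slope z on = begin
    + q ℤ.* (+ x z ℤ.- + x u)                                       ≡⟨ e (+ q) (+ p) (+ x z) (+ x u) (+ s u) ⟩
    (+ q ℤ.* + x z ℤ.+ + p ℤ.* + s u) ℤ.- (+ q ℤ.* + x u ℤ.+ + p ℤ.* + s u)
      ≡⟨ cong (ℤ._- (+ q ℤ.* + x u ℤ.+ + p ℤ.* + s u)) (trans (sym (cast q (x z) p (s u))) (trans (cong +_ (sym on)) (cast q (x u) p (s z)))) ⟩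
    (+ q ℤ.* + x u ℤ.+ + p ℤ.* + s z) ℤ.- (+ q ℤ.* + x u ℤ.+ + p ℤ.* + s u)
      ≡⟨ e′ (+ q) (+ p) (+ x u) (+ s z) (+ s u) ⟩
    + p ℤ.* (+ s z ℤ.- + s u)                                       ∎
    where
    e : ∀ q p xz xu su → q ℤ.* (xz ℤ.- xu) ≡ (q ℤ.* xz ℤ.+ p ℤ.* su) ℤ.- (q ℤ.* xu ℤ.+ p ℤ.* su)
    e = ℤ-solve-∀
    e′ : ∀ q p xu sz su → (q ℤ.* xu ℤ.+ p ℤ.* sz) ℤ.- (q ℤ.* xu ℤ.+ p ℤ.* su) ≡ p ℤ.* (sz ℤ.- su)
    e′ = ℤ-solve-∀

-- Definitionally `m * long-window` at `Q = 128 * m`.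
threshold : ℕ → ℕ
threshold m = m * (suc (32 * m) * (Q * Q) ^ suc (suc (8 * m) * (Q * Q * (Q * Q))))
  where Q = 128 * m

-- `Y` is the ordinate, reflected for a decreasing set. Unlike a single coordinate, `x + Y` grows
-- strictly along horizontal and vertical steps alike, and the change from `y` to `x + Y` is affine,
-- so collinearity can be transported back.
module Increasing (S : List Point) (Y : Point → ℕ) (unique : Unique S)
  (increasing : ∀ {u v} → u ∈ S → v ∈ S → proj₁ u < proj₁ v → Y u ≤ Y v)
  (Y-injective : ∀ {u v} → u ∈ S → v ∈ S → Y u ≡ Y v → proj₂ u ≡ proj₂ v)
  (cross⇒collinear : ∀ {u v w} → u ∈ S → v ∈ S → w ∈ S →
    (xc v ℤ.- xc u) ℤ.* (+ (proj₁ w + Y w) ℤ.- + (proj₁ u + Y u)) ≡ (+ (proj₁ v + Y v) ℤ.- + (proj₁ u + Y u)) ℤ.* (xc w ℤ.- xc u) →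
    Collinear u v w)
  (generalPosition : GeneralPosition S) where

  s : Point → ℕ
  s p = proj₁ p + Y p

  chain : ∀ {u v} → u ∈ S → v ∈ S → s u ≤ s v → proj₁ u ≤ proj₁ v × proj₁ v + s u ≤ proj₁ u + s v
  chain {u} {v} u∈ v∈ su≤sv with <-cmp (proj₁ u) (proj₁ v)
  ... | tri< u<v _ _ = <⇒≤ u<v , (begin
      proj₁ v + (proj₁ u + Y u)    ≤⟨ +-monoʳ-≤ (proj₁ v) (+-monoʳ-≤ (proj₁ u) (increasing u∈ v∈ u<v)) ⟩
      proj₁ v + (proj₁ u + Y v)    ≡⟨ e (proj₁ v) (proj₁ u) (Y v) ⟩
      proj₁ u + (proj₁ v + Y v)    ∎)
    where
    open ≤-Reasoning
    e : ∀ a b c → a + (b + c) ≡ b + (a + c)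
    e = solve-∀
  ... | tri≈ _ u≡v _ = ≤-reflexive u≡v , +-mono-≤ (≤-reflexive (sym u≡v)) su≤sv
  ... | tri> _ _ v<u = contradiction su≤sv (<⇒≱ (+-mono-<-≤ v<u (increasing v∈ u∈ v<u)))

  s-injective : ∀ {u v} → u ∈ S → v ∈ S → s u ≡ s v → ¬ u ≢ v
  s-injective {u} {v} u∈ v∈ eq u≢v = u≢v (cong₂ _,_ x≡ (Y-injective u∈ v∈ Y≡))
    where
    x≡ : proj₁ u ≡ proj₁ v
    x≡ = ≤-antisym (proj₁ (chain u∈ v∈ (≤-reflexive eq))) (proj₁ (chain v∈ u∈ (≤-reflexive (sym eq))))
    Y≡ : Y u ≡ Y v
    Y≡ = +-cancelˡ-≡ (proj₁ u) _ _ (trans eq (cong (_+ Y v) (sym x≡)))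

  no-line : ∀ {u v w} → u ∈ S → v ∈ S → w ∈ S → u ≢ v → v ≢ w → u ≢ w → ∀ p q → 1 ≤ q →
    q * proj₁ u + p * s v ≡ q * proj₁ v + p * s u → q * proj₁ u + p * s w ≡ q * proj₁ w + p * s u → ⊥
  no-line {u} {v} {w} u∈ v∈ w∈ u≢v v≢w u≢w p q 1≤q on-v on-w = generalPosition u∈ v∈ w∈ u≢v v≢w u≢w
    (cross⇒collinear u∈ v∈ w∈ (line⇒cross q p proj₁ s u v w {{>-nonZero 1≤q}} on-v on-w))

  size-bound : ∀ m .{{_ : NonZero m}} k → threshold m ≤ k → (∀ {z} → z ∈ S → s z < 2 * k) → m * length S ≤ k
  size-bound m = Chain.Descent.chain-bound S proj₁ s unique chain s-injective no-line m (128 * m) {{it}} {{m*n≢0 128 m}} refl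

upper-bound : ∀ m → 1 ≤ m → ∃ λ K → ∀ k → k ≥ K → ∀ S → MGPSubset k S → m * length S ≤ k
upper-bound m 1≤m = threshold m , bound
  where
  instance
    m≢0 : NonZero m
    m≢0 = >-nonZero 1≤m
  x+y<2k : ∀ {k a b} → a < k → b < k → a + b < 2 * k
  x+y<2k {k} {a} {b} a<k b<k = subst (a + b <_) (cong (λ t → k + t) (sym (+-identityʳ k))) (+-mono-< a<k b<k)
  bound : ∀ k → k ≥ threshold m → ∀ S → MGPSubset k S → m * length S ≤ k
  bound k k≥K S (unique , inGrid , inj₁ increasing , gp) =
      Increasing.size-bound S proj₂ unique increasing (λ _ _ eq → eq)
        (λ {u} {v} {w} _ _ _ eq → cross (xc u) (yc u) (xc v) (yc v) (xc w) (yc w) eq) gp m k k≥K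
        (λ z∈ → let x< , y< = All.lookup inGrid z∈ in x+y<2k x< y<)
    where
    cross : ∀ a b c d e f → (c ℤ.- a) ℤ.* ((e ℤ.+ f) ℤ.- (a ℤ.+ b)) ≡ ((c ℤ.+ d) ℤ.- (a ℤ.+ b)) ℤ.* (e ℤ.- a) →
      (c ℤ.- a) ℤ.* (f ℤ.- b) ≡ (d ℤ.- b) ℤ.* (e ℤ.- a)
    cross a b c d e f eq = trans (e₁ a b c e f) (trans (cong (ℤ._- (c ℤ.- a) ℤ.* (e ℤ.- a)) eq) (e₂ a b c d e))
      where
      e₁ : ∀ a b c e f → (c ℤ.- a) ℤ.* (f ℤ.- b) ≡ (c ℤ.- a) ℤ.* ((e ℤ.+ f) ℤ.- (a ℤ.+ b)) ℤ.- (c ℤ.- a) ℤ.* (e ℤ.- a)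
      e₁ = ℤ-solve-∀
      e₂ : ∀ a b c d e → ((c ℤ.+ d) ℤ.- (a ℤ.+ b)) ℤ.* (e ℤ.- a) ℤ.- (c ℤ.- a) ℤ.* (e ℤ.- a) ≡ (d ℤ.- b) ℤ.* (e ℤ.- a)
      e₂ = ℤ-solve-∀
  bound k k≥K S (unique , inGrid , inj₂ decreasing , gp) =
      Increasing.size-bound S Y unique
        (λ u∈ v∈ u<v → ∸-monoʳ-≤ k (s≤s (decreasing u∈ v∈ u<v)))
        (λ u∈ v∈ eq → suc-injective (∸-cancelˡ-≡ (y<k u∈) (y<k v∈) eq))
        (λ {u} {v} {w} u∈ v∈ w∈ eq → reflect (xc u) (yc u) (xc v) (yc v) (xc w) (yc w) (+ k) (Y≡ u∈) (Y≡ v∈) (Y≡ w∈) eq)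
        gp m k k≥K
        (λ z∈ → let x< , y< = All.lookup inGrid z∈ in x+y<2k x< (∸-monoʳ-< {k} (s≤s z≤n) y<))
    where
    -- The `suc` makes this reflection map `[0, k)` onto itself, which the bound `s z < 2 * k`
    -- needs.
    Y : Point → ℕ
    Y p = k ∸ suc (proj₂ p)
    y<k : ∀ {z} → z ∈ S → proj₂ z < k
    y<k z∈ = proj₂ (All.lookup inGrid z∈)
    Y≡ : ∀ {z} → z ∈ S → + Y z ≡ + k ℤ.- (ℤ.1ℤ ℤ.+ yc z)
    Y≡ {z} z∈ = trans (sym (ℤ.⊖-≥ (y<k z∈))) (sym (ℤ.m-n≡m⊖n k (suc (proj₂ z))))
    cross : ∀ a b c d e f k → (c ℤ.- a) ℤ.* ((e ℤ.+ (k ℤ.- (ℤ.1ℤ ℤ.+ f))) ℤ.- (a ℤ.+ (k ℤ.- (ℤ.1ℤ ℤ.+ b)))) ≡ ((c ℤ.+ (k ℤ.- (ℤ.1ℤ ℤ.+ d))) ℤ.- (a ℤ.+ (k ℤ.- (ℤ.1ℤ ℤ.+ b)))) ℤ.* (e ℤ.- a) →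
      (c ℤ.- a) ℤ.* (f ℤ.- b) ≡ (d ℤ.- b) ℤ.* (e ℤ.- a)
    cross a b c d e f k eq = begin
      (c ℤ.- a) ℤ.* (f ℤ.- b)
        ≡⟨ e₁ a b c e f k ⟩
      (c ℤ.- a) ℤ.* (e ℤ.- a) ℤ.- (c ℤ.- a) ℤ.* ((e ℤ.+ (k ℤ.- (ℤ.1ℤ ℤ.+ f))) ℤ.- (a ℤ.+ (k ℤ.- (ℤ.1ℤ ℤ.+ b))))
        ≡⟨ cong (λ t → (c ℤ.- a) ℤ.* (e ℤ.- a) ℤ.- t) eq ⟩
      (c ℤ.- a) ℤ.* (e ℤ.- a) ℤ.- ((c ℤ.+ (k ℤ.- (ℤ.1ℤ ℤ.+ d))) ℤ.- (a ℤ.+ (k ℤ.- (ℤ.1ℤ ℤ.+ b)))) ℤ.* (e ℤ.- a)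
        ≡⟨ e₂ a b c d e k ⟩
      (d ℤ.- b) ℤ.* (e ℤ.- a) ∎
      where
      open ≡-Reasoning
      e₁ : ∀ a b c e f k → (c ℤ.- a) ℤ.* (f ℤ.- b) ≡ (c ℤ.- a) ℤ.* (e ℤ.- a) ℤ.- (c ℤ.- a) ℤ.* ((e ℤ.+ (k ℤ.- (ℤ.1ℤ ℤ.+ f))) ℤ.- (a ℤ.+ (k ℤ.- (ℤ.1ℤ ℤ.+ b))))
      e₁ = ℤ-solve-∀
      e₂ : ∀ a b c d e k → (c ℤ.- a) ℤ.* (e ℤ.- a) ℤ.- ((c ℤ.+ (k ℤ.- (ℤ.1ℤ ℤ.+ d))) ℤ.- (a ℤ.+ (k ℤ.- (ℤ.1ℤ ℤ.+ b)))) ℤ.* (e ℤ.- a) ≡ (d ℤ.- b) ℤ.* (e ℤ.- a)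
      e₂ = ℤ-solve-∀
    reflect : ∀ a b c d e f k {b′ d′ f′} →
      b′ ≡ k ℤ.- (ℤ.1ℤ ℤ.+ b) → d′ ≡ k ℤ.- (ℤ.1ℤ ℤ.+ d) → f′ ≡ k ℤ.- (ℤ.1ℤ ℤ.+ f) →
      (c ℤ.- a) ℤ.* ((e ℤ.+ f′) ℤ.- (a ℤ.+ b′)) ≡ ((c ℤ.+ d′) ℤ.- (a ℤ.+ b′)) ℤ.* (e ℤ.- a) →
      (c ℤ.- a) ℤ.* (f ℤ.- b) ≡ (d ℤ.- b) ℤ.* (e ℤ.- a)
    reflect a b c d e f k refl refl refl = cross a b c d e f k

theorem1p5 :
    -- lower bound Ω((n / log n)^{2/5}) with n = k², i.e. n² ≤ C · f^5 · (log n)²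
    (∃ λ C → ∃ λ K → ∀ k → k ≥ K →
      Σ (List Point) λ S → MGPSubset k S ×
        ((k * k) ^ 2 ≤ C * (length S ^ 5) * (⌊log₂ (k * k) ⌋ ^ 2)))
    ×
    -- upper bound o(n^{1/2}) = o(k): for every m ≥ 1, eventually m·|S| ≤ k
    (∀ m → 1 ≤ m → ∃ λ K → ∀ k → k ≥ K →
      ∀ S → MGPSubset k S → m * length S ≤ k)
theorem1p5 = lower-bound , upper-bound
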